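{- Let $R$ be a finite commutative local ring with unity, and let $n=|R|$. Let $T_\Gamma(R)$ be the total graph of $R$. (1) If $2 \notin U(R)$, then $$SO(T_\Gamma(R)) = \frac{n(n-|U(R)|-1)^2}{\sqrt{2}}.$$ (2) If $2 \in U(R)$, then $$SO(T_\Gamma(R)) = \frac{(n-|U(R)|)(n-|U(R)|-1)^2}{\sqrt{2}}+\frac{|U(R)|\,(n-|U(R)|)^2}{\sqrt{2}}.$$
   Context: For a finite simple graph $G$, the Sombor index is $SO(G)=\sum_{uv\in E(G)}\sqrt{d_u^2+d_v^2}$, the sum being over (unordered) edges, where $d_x$ is the degree of the vertex $x$. For a commutative ring $R$ with unity, $Z(R)$ denotes the set of zero-divisors of $R$, including $0$, and $U(R)$ denotes the set of units of $R$; here $2=1+1\in R$. The total graph $T_\Gamma(R)$ is the simple graph whose vertices are all elements of $R$, with distinct vertices $x,y$ adjacent if and only if $x+y\in Z(R)$. -}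

module Defs where

open import Algebra.Bundles using (CommutativeMonoid; CommutativeRing)
open import Algebra.Definitions using (Invertible)
open import Data.Fin.Base using (Fin)
open import Data.Fin.Properties using () renaming (_<?_ to _<ᶠ?_; _≟_ to _≟ᶠ_; any? to anyᶠ?)
open import Data.Integer.Base as ℤ using (+_)
import Data.Integer.Properties as ℤₚ
open import Data.List.Base as List using (List; allFin; cartesianProduct; filter; foldr; length)
open import Data.Nat.Base as ℕ using (ℕ; zero; suc)
open import Data.Nat.Coprimality using (1-coprimeTo)
import Data.Nat.Properties as ℕₚ
open import Data.Nat.Tactic.RingSolver using (solve-∀)
open import Data.Product.Base using (∃; ∃-syntax; _×_; _,_; proj₁; proj₂)
open import Data.Product using (∃!)
open import Data.Rational.Base as ℚ using (ℚ; mkℚ; 0ℚ; 1ℚ; ½; ∣_∣; 1/_)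
import Data.Rational.Properties as ℚₚ
open import Data.Rational.Solver using (module +-*-Solver)
open import Data.Rational.Unnormalised.Base as ℚᵘ using (mkℚᵘ)
import Data.Rational.Unnormalised.Properties as ℚᵘₚ
open import Data.Sum.Base as Sum using (_⊎_; inj₁; inj₂)
open import Function.Base using (_∘_)
open import Function.Bundles using (Inverse)
open import Level using (Level; _⊔_) renaming (suc to lsuc)
open import Relation.Binary.Bundles using (Setoid)
open import Relation.Binary.Core using (Rel)
open import Relation.Binary.Definitions using (Decidable; Symmetric; _Respects_; _Respects₂_)
open import Relation.Binary.PropositionalEquality as ≡
  using (_≡_; _≢_; refl; sym; trans; cong; cong₂; subst; subst₂)
open import Relation.Nullary.Decidable using (Dec; yes; no; map′; ¬?; _×-dec_; _⊎-dec_)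
open import Relation.Nullary.Negation using (¬_; contradiction)
open import Relation.Unary using (Pred; _∈_; _⊆_; _≐_)
import Relation.Unary as Unary
open import Algebra.Properties.CommutativeSemigroup
  (CommutativeMonoid.commutativeSemigroup ℚₚ.*-1-commutativeMonoid) using (interchange)

private variable
  c ℓ p v e a : Level

------------------------------------------------------------------------
-- Real numbers: Cauchy sequences of rationals, with the equality _≃_

IsCauchy : (ℕ → ℚ) → Set
IsCauchy s = ∀ ε → 0ℚ ℚ.< ε →
  ∃[ N ] (∀ m n → N ℕ.≤ m → N ℕ.≤ n → ∣ s m ℚ.- s n ∣ ℚ.< ε)

record ℝ : Set where
  constructor mkℝ
  field
    seq    : ℕ → ℚ
    cauchy : IsCauchy seq

open ℝ public

infix 4 _≃_

_≃_ : ℝ → ℝ → Set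
x ≃ y = ∀ ε → 0ℚ ℚ.< ε →
  ∃[ N ] (∀ n → N ℕ.≤ n → ∣ seq x n ℚ.- seq y n ∣ ℚ.< ε)

private
  module _ where
    open +-*-Solver

    +-difference : ∀ a b c d → (a ℚ.- b) ℚ.+ (c ℚ.- d) ≡ (a ℚ.+ c) ℚ.- (b ℚ.+ d)
    +-difference = solve 4 (λ a b c d → (a :- b) :+ (c :- d) := (a :+ c) :- (b :+ d)) refl

    sub-add : ∀ a b → (a ℚ.- b) ℚ.+ b ≡ a
    sub-add = solve 2 (λ a b → (a :- b) :+ b := a) refl

    add-sub : ∀ a b → a ℚ.+ b ℚ.- b ≡ a
    add-sub = solve 2 (λ a b → a :+ b :- b := a) refl

    neg-sub : ∀ a b → ℚ.- (a ℚ.- b) ≡ b ℚ.- a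
    neg-sub = solve 2 (λ a b → :- (a :- b) := b :- a) refl

    telescope : ∀ a b c → (a ℚ.- b) ℚ.+ (b ℚ.- c) ≡ a ℚ.- c
    telescope = solve 3 (λ a b c → (a :- b) :+ (b :- c) := a :- c) refl

  *-sub : ∀ a b c → a ℚ.* (b ℚ.- c) ≡ a ℚ.* b ℚ.- a ℚ.* c
  *-sub a b c = trans (ℚₚ.*-distribˡ-+ a b (ℚ.- c))
    (cong (a ℚ.* b ℚ.+_) (sym (ℚₚ.neg-distribʳ-* a c)))

  *-difference : ∀ a b c d → a ℚ.* (c ℚ.- d) ℚ.+ d ℚ.* (a ℚ.- b) ≡ a ℚ.* c ℚ.- b ℚ.* d
  *-difference a b c d = trans
    (cong₂ ℚ._+_ (*-sub a c d)
      (trans (*-sub d a b) (cong₂ ℚ._-_ (ℚₚ.*-comm d a) (ℚₚ.*-comm d b))))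
    (telescope (a ℚ.* c) (a ℚ.* d) (b ℚ.* d))

  recip-difference : ∀ a b p q → (p ℚ.* q) ℚ.* (b ℚ.- a) ≡ p ℚ.* (b ℚ.* q) ℚ.- q ℚ.* (a ℚ.* p)
  recip-difference a b p q = trans (*-sub (p ℚ.* q) b a) (cong₂ ℚ._-_
    (trans (ℚₚ.*-assoc p q b) (cong (p ℚ.*_) (ℚₚ.*-comm q b)))
    (trans (cong (ℚ._* a) (ℚₚ.*-comm p q))
      (trans (ℚₚ.*-assoc q p a) (cong (q ℚ.*_) (ℚₚ.*-comm p a)))))

  regroup : ∀ d k z → (k ℚ.* k) ℚ.* (d ℚ.* d ℚ.* z) ≡ (d ℚ.* k) ℚ.* (d ℚ.* k) ℚ.* z
  regroup d k z = trans (sym (ℚₚ.*-assoc (k ℚ.* k) (d ℚ.* d) z)) (cong (ℚ._* z)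
    (trans (ℚₚ.*-comm (k ℚ.* k) (d ℚ.* d)) (interchange d d k k)))

  half-pos : ∀ {ε} → 0ℚ ℚ.< ε → 0ℚ ℚ.< ½ ℚ.* ε
  half-pos {ε} ε>0 = subst (ℚ._< ½ ℚ.* ε) (ℚₚ.*-zeroʳ ½) (ℚₚ.*-monoʳ-<-pos ½ ε>0)

  halves : ∀ ε → ½ ℚ.* ε ℚ.+ ½ ℚ.* ε ≡ ε
  halves ε = trans (sym (ℚₚ.*-distribʳ-+ ε ½ ½)) (ℚₚ.*-identityˡ ε)

  *-pos : ∀ {x y} → 0ℚ ℚ.< x → 0ℚ ℚ.< y → 0ℚ ℚ.< x ℚ.* y
  *-pos {x} {y} x>0 y>0 = subst (ℚ._< x ℚ.* y) (ℚₚ.*-zeroʳ x)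
    (ℚₚ.*-monoʳ-<-pos x {{ℚ.positive x>0}} y>0)

  *-mono-≤-< : ∀ {x X y Y} → 0ℚ ℚ.< X → x ℚ.≤ X → 0ℚ ℚ.≤ y → y ℚ.< Y → x ℚ.* y ℚ.< X ℚ.* Y
  *-mono-≤-< {x} {X} {y} {Y} X>0 x≤X y≥0 y<Y = ℚₚ.≤-<-trans
    (ℚₚ.*-monoʳ-≤-nonNeg y {{ℚ.nonNegative y≥0}} x≤X)
    (ℚₚ.*-monoʳ-<-pos X {{ℚ.positive X>0}} y<Y)

  *-mono-≤-nonNeg : ∀ {x X y Y} → 0ℚ ℚ.≤ X → x ℚ.≤ X → 0ℚ ℚ.≤ y → y ℚ.≤ Y → x ℚ.* y ℚ.≤ X ℚ.* Y
  *-mono-≤-nonNeg {x} {X} {y} {Y} X≥0 x≤X y≥0 y≤Y = ℚₚ.≤-trans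
    (ℚₚ.*-monoʳ-≤-nonNeg y {{ℚ.nonNegative y≥0}} x≤X)
    (ℚₚ.*-monoˡ-≤-nonNeg X {{ℚ.nonNegative X≥0}} y≤Y)

  const-cauchy : ∀ q → IsCauchy (λ _ → q)
  const-cauchy q ε ε>0 = 0 , λ _ _ _ _ → subst (ℚ._< ε) (cong ∣_∣ (sym (ℚₚ.+-inverseʳ q))) ε>0

  +-cauchy : ∀ {s t} → IsCauchy s → IsCauchy t → IsCauchy (λ n → s n ℚ.+ t n)
  +-cauchy {s} {t} cs ct ε ε>0 with cs (½ ℚ.* ε) (half-pos ε>0) | ct (½ ℚ.* ε) (half-pos ε>0)
  ... | N , hN | M , hM = N ℕ.⊔ M , λ m n m≥ n≥ →
    ℚₚ.≤-<-trans
      (subst (λ z → ∣ z ∣ ℚ.≤ ∣ s m ℚ.- s n ∣ ℚ.+ ∣ t m ℚ.- t n ∣)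
        (+-difference (s m) (s n) (t m) (t n))
        (ℚₚ.∣p+q∣≤∣p∣+∣q∣ (s m ℚ.- s n) (t m ℚ.- t n)))
      (subst (∣ s m ℚ.- s n ∣ ℚ.+ ∣ t m ℚ.- t n ∣ ℚ.<_) (halves ε)
        (ℚₚ.+-mono-< (hN m n (ℕₚ.m⊔n≤o⇒m≤o N M m≥) (ℕₚ.m⊔n≤o⇒m≤o N M n≥))
                     (hM m n (ℕₚ.m⊔n≤o⇒n≤o N M m≥) (ℕₚ.m⊔n≤o⇒n≤o N M n≥))))

  neg-cauchy : ∀ {s} → IsCauchy s → IsCauchy (λ n → ℚ.- s n)
  neg-cauchy {s} cs ε ε>0 with cs ε ε>0
  ... | N , h = N , λ m n m≥ n≥ → subst (ℚ._< ε)
      (trans (sym (ℚₚ.∣-p∣≡∣p∣ (s m ℚ.- s n))) (cong ∣_∣ (ℚₚ.neg-distrib-+ (s m) (ℚ.- s n))))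
      (h m n m≥ n≥)

  eventually-bounded : ∀ {s} → IsCauchy s →
    ∃[ B ] (0ℚ ℚ.< B × ∃[ N ] (∀ n → N ℕ.≤ n → ∣ s n ∣ ℚ.≤ B))
  eventually-bounded {s} cs with cs 1ℚ (ℚₚ.positive⁻¹ 1ℚ)
  ... | N , h = 1ℚ ℚ.+ ∣ s N ∣
    , ℚₚ.+-mono-<-≤ (ℚₚ.positive⁻¹ 1ℚ) (ℚₚ.0≤∣p∣ (s N))
    , N , λ n n≥ → ℚₚ.≤-trans
        (subst (λ z → ∣ z ∣ ℚ.≤ ∣ s n ℚ.- s N ∣ ℚ.+ ∣ s N ∣) (sub-add (s n) (s N))
          (ℚₚ.∣p+q∣≤∣p∣+∣q∣ (s n ℚ.- s N) (s N)))
        (ℚₚ.+-monoˡ-≤ ∣ s N ∣ (ℚₚ.<⇒≤ (h n N n≥ ℕₚ.≤-refl)))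

-- The value at 0 is junk; division below is only available away from 0.
recip : ℚ → ℚ
recip q with q ℚₚ.≟ 0ℚ
... | yes _   = 0ℚ
... | no  q≢0 = (1/ q) {{ℚ.≢-nonZero q≢0}}

private
  recip-inverse : ∀ q → q ≢ 0ℚ → q ℚ.* recip q ≡ 1ℚ
  recip-inverse q q≢0 with q ℚₚ.≟ 0ℚ
  ... | yes q≡0 = contradiction q≡0 q≢0
  ... | no  q≢0 = ℚₚ.*-inverseʳ q {{ℚ.≢-nonZero q≢0}}

  pos⇒≢0 : ∀ {q} → 0ℚ ℚ.< q → q ≢ 0ℚ
  pos⇒≢0 q>0 = ℚₚ.<⇒≢ q>0 ∘ sym

  recip-pos : ∀ {q} → 0ℚ ℚ.< q → 0ℚ ℚ.< recip q
  recip-pos {q} q>0 = ℚₚ.*-cancelˡ-<-nonNeg q {{ℚ.nonNegative (ℚₚ.<⇒≤ q>0)}}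
    (subst₂ ℚ._<_ (sym (ℚₚ.*-zeroʳ q)) (sym (recip-inverse q (pos⇒≢0 q>0))) (ℚₚ.positive⁻¹ 1ℚ))

  *-close : ∀ {a b c d B C δ ε} → 0ℚ ℚ.< B → 0ℚ ℚ.< C → B ℚ.* δ ℚ.+ C ℚ.* δ ≡ ε →
    ∣ a ∣ ℚ.≤ B → ∣ d ∣ ℚ.≤ C → ∣ a ℚ.- b ∣ ℚ.< δ → ∣ c ℚ.- d ∣ ℚ.< δ →
    ∣ a ℚ.* c ℚ.- b ℚ.* d ∣ ℚ.< ε
  *-close {a} {b} {c} {d} {B} {C} {δ} {ε} B>0 C>0 total a≤B d≤C ab<δ cd<δ = begin-strict
    ∣ a ℚ.* c ℚ.- b ℚ.* d ∣                            ≡⟨ cong ∣_∣ (*-difference a b c d) ⟨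
    ∣ a ℚ.* (c ℚ.- d) ℚ.+ d ℚ.* (a ℚ.- b) ∣            ≤⟨ ℚₚ.∣p+q∣≤∣p∣+∣q∣ (a ℚ.* (c ℚ.- d)) (d ℚ.* (a ℚ.- b)) ⟩
    ∣ a ℚ.* (c ℚ.- d) ∣ ℚ.+ ∣ d ℚ.* (a ℚ.- b) ∣        ≡⟨ cong₂ ℚ._+_ (ℚₚ.∣p*q∣≡∣p∣*∣q∣ a (c ℚ.- d)) (ℚₚ.∣p*q∣≡∣p∣*∣q∣ d (a ℚ.- b)) ⟩
    ∣ a ∣ ℚ.* ∣ c ℚ.- d ∣ ℚ.+ ∣ d ∣ ℚ.* ∣ a ℚ.- b ∣    <⟨ ℚₚ.+-mono-< (*-mono-≤-< B>0 a≤B (ℚₚ.0≤∣p∣ (c ℚ.- d)) cd<δ)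
                                                                       (*-mono-≤-< C>0 d≤C (ℚₚ.0≤∣p∣ (a ℚ.- b)) ab<δ) ⟩
    B ℚ.* δ ℚ.+ C ℚ.* δ                                ≡⟨ total ⟩
    ε                                                  ∎
    where open ℚₚ.≤-Reasoning

  split : ∀ B C ε → 0ℚ ℚ.< B → 0ℚ ℚ.< C → 0ℚ ℚ.< ε →
    ∃[ δ ] (0ℚ ℚ.< δ × B ℚ.* δ ℚ.+ C ℚ.* δ ≡ ε)
  split B C ε B>0 C>0 ε>0 = recip (B ℚ.+ C) ℚ.* ε , *-pos (recip-pos B+C>0) ε>0 ,
    trans (sym (ℚₚ.*-distribʳ-+ (recip (B ℚ.+ C) ℚ.* ε) B C))
      (trans (sym (ℚₚ.*-assoc (B ℚ.+ C) (recip (B ℚ.+ C)) ε))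
      (trans (cong (ℚ._* ε) (recip-inverse (B ℚ.+ C) (pos⇒≢0 B+C>0))) (ℚₚ.*-identityˡ ε)))
    where
    B+C>0 : 0ℚ ℚ.< B ℚ.+ C
    B+C>0 = ℚₚ.+-mono-< B>0 C>0

  EventuallyBounded : (ℕ → ℚ) → Set
  EventuallyBounded s = ∃[ B ] (0ℚ ℚ.< B × ∃[ N ] (∀ n → N ℕ.≤ n → ∣ s n ∣ ℚ.≤ B))

  -- No with-abstraction here: it would normalise products in ℚ.
  *-cauchy : ∀ {s t} → IsCauchy s → IsCauchy t → IsCauchy (λ n → s n ℚ.* t n)
  *-cauchy {s} {t} cs ct ε ε>0 = choose-δ (eventually-bounded cs) (eventually-bounded ct)
    where
    Goal : Set
    Goal = ∃[ N ] (∀ m n → N ℕ.≤ m → N ℕ.≤ n → ∣ s m ℚ.* t m ℚ.- s n ℚ.* t n ∣ ℚ.< ε)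

    module _ (B C : ℚ) (B>0 : 0ℚ ℚ.< B) (C>0 : 0ℚ ℚ.< C)
             (N₁ N₂ : ℕ) (hB : ∀ n → N₁ ℕ.≤ n → ∣ s n ∣ ℚ.≤ B) (hC : ∀ n → N₂ ℕ.≤ n → ∣ t n ∣ ℚ.≤ C)
             (δ : ℚ) (total : B ℚ.* δ ℚ.+ C ℚ.* δ ≡ ε) where
      finish : ∃[ N ] (∀ m n → N ℕ.≤ m → N ℕ.≤ n → ∣ s m ℚ.- s n ∣ ℚ.< δ) →
               ∃[ N ] (∀ m n → N ℕ.≤ m → N ℕ.≤ n → ∣ t m ℚ.- t n ∣ ℚ.< δ) → Goal
      finish (N₃ , hs) (N₄ , ht) = (N₁ ℕ.⊔ N₂) ℕ.⊔ (N₃ ℕ.⊔ N₄) , λ m n m≥ n≥ →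
        *-close {s m} {s n} {t m} {t n} B>0 C>0 total
          (hB m (≥₁ m≥)) (hC n (≥₂ n≥)) (hs m n (≥₃ m≥) (≥₃ n≥)) (ht m n (≥₄ m≥) (≥₄ n≥))
        where
        module _ {k : ℕ} (k≥ : (N₁ ℕ.⊔ N₂) ℕ.⊔ (N₃ ℕ.⊔ N₄) ℕ.≤ k) where
          ≥₁₂ = ℕₚ.m⊔n≤o⇒m≤o (N₁ ℕ.⊔ N₂) (N₃ ℕ.⊔ N₄) k≥
          ≥₃₄ = ℕₚ.m⊔n≤o⇒n≤o (N₁ ℕ.⊔ N₂) (N₃ ℕ.⊔ N₄) k≥
          ≥₁ = ℕₚ.m⊔n≤o⇒m≤o N₁ N₂ ≥₁₂
          ≥₂ = ℕₚ.m⊔n≤o⇒n≤o N₁ N₂ ≥₁₂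
          ≥₃ = ℕₚ.m⊔n≤o⇒m≤o N₃ N₄ ≥₃₄
          ≥₄ = ℕₚ.m⊔n≤o⇒n≤o N₃ N₄ ≥₃₄

    choose-δ : EventuallyBounded s → EventuallyBounded t → Goal
    choose-δ (B , B>0 , N₁ , hB) (C , C>0 , N₂ , hC) = use (split B C ε B>0 C>0 ε>0)
      where
      use : ∃[ δ ] (0ℚ ℚ.< δ × B ℚ.* δ ℚ.+ C ℚ.* δ ≡ ε) → Goal
      use (δ , δ>0 , total) = finish B C B>0 C>0 N₁ N₂ hB hC δ total (cs δ δ>0) (ct δ δ>0)

infixl 6 _+_ _-_
infixl 7 _*_ _/_
infix  8 -_ _²

_+_ : ℝ → ℝ → ℝ
x + y = mkℝ (λ n → seq x n ℚ.+ seq y n) (+-cauchy {seq x} {seq y} (cauchy x) (cauchy y))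

-_ : ℝ → ℝ
- x = mkℝ (λ n → ℚ.- seq x n) (neg-cauchy {seq x} (cauchy x))

_-_ : ℝ → ℝ → ℝ
x - y = x + (- y)

_*_ : ℝ → ℝ → ℝ
x * y = mkℝ (λ n → seq x n ℚ.* seq y n) (*-cauchy {seq x} {seq y} (cauchy x) (cauchy y))

_² : ℝ → ℝ
x ² = x * x

fromℚ : ℚ → ℝ
fromℚ q = mkℝ (λ _ → q) (const-cauchy q)

fromℕ : ℕ → ℝ
fromℕ n = fromℚ ((+ n) ℚ./ 1)

0ℝ 1ℝ : ℝ
0ℝ = fromℕ 0
1ℝ = fromℕ 1

record ApartFromZero (x : ℝ) : Set where
  field
    δ     : ℚ
    δ>0   : 0ℚ ℚ.< δ
    start : ℕ
    bound : ∀ n → start ℕ.≤ n → δ ℚ.≤ ∣ seq x n ∣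

private
  recip-cauchy : ∀ x → ApartFromZero x → IsCauchy (recip ∘ seq x)
  recip-cauchy x x#0 ε ε>0 = start ℕ.⊔ proj₁ Nx , λ m n m≥ n≥ →
    let m≥s = ℕₚ.m⊔n≤o⇒m≤o start _ m≥
        n≥s = ℕₚ.m⊔n≤o⇒m≤o start _ n≥
        d   = proj₂ Nx n m (ℕₚ.m⊔n≤o⇒n≤o start _ n≥) (ℕₚ.m⊔n≤o⇒n≤o start _ m≥)
    in subst₂ ℚ._<_
         (sym (trans (cong ∣_∣ (difference m n m≥s n≥s))
                (trans (ℚₚ.∣p*q∣≡∣p∣*∣q∣ (r m ℚ.* r n) (s n ℚ.- s m))
                       (cong (ℚ._* ∣ s n ℚ.- s m ∣) (ℚₚ.∣p*q∣≡∣p∣*∣q∣ (r m) (r n))))))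
         total
         (*-mono-≤-< (*-pos κ>0 κ>0)
           (*-mono-≤-nonNeg (ℚₚ.<⇒≤ κ>0) (r≤κ m m≥s) (ℚₚ.0≤∣p∣ _) (r≤κ n n≥s))
           (ℚₚ.0≤∣p∣ _) d)
    where
    open ApartFromZero x#0
    s = seq x
    r = recip ∘ s
    κ = recip δ
    κ>0 = recip-pos δ>0
    Nx = cauchy x (δ ℚ.* δ ℚ.* ε) (*-pos (*-pos δ>0 δ>0) ε>0)
    δκ≡1 : δ ℚ.* κ ≡ 1ℚ
    δκ≡1 = recip-inverse δ (pos⇒≢0 δ>0)
    s≢0 : ∀ n → start ℕ.≤ n → s n ≢ 0ℚ
    s≢0 n n≥ sn≡0 = ℚₚ.<⇒≢ (ℚₚ.<-≤-trans δ>0 (bound n n≥)) (sym (cong ∣_∣ sn≡0))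
    sr≡1 : ∀ n → start ℕ.≤ n → s n ℚ.* r n ≡ 1ℚ
    sr≡1 n n≥ = recip-inverse (s n) (s≢0 n n≥)
    r≤κ : ∀ n → start ℕ.≤ n → ∣ r n ∣ ℚ.≤ κ
    r≤κ n n≥ = ℚₚ.*-cancelˡ-≤-pos δ {{ℚ.positive δ>0}}
      (subst (δ ℚ.* ∣ r n ∣ ℚ.≤_)
        (trans (sym (ℚₚ.∣p*q∣≡∣p∣*∣q∣ (s n) (r n))) (trans (cong ∣_∣ (sr≡1 n n≥)) (sym δκ≡1)))
        (ℚₚ.*-monoʳ-≤-nonNeg ∣ r n ∣ {{ℚ.nonNegative (ℚₚ.0≤∣p∣ (r n))}} (bound n n≥)))
    difference : ∀ m n → start ℕ.≤ m → start ℕ.≤ n →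
      r m ℚ.- r n ≡ (r m ℚ.* r n) ℚ.* (s n ℚ.- s m)
    difference m n m≥ n≥ = sym (trans (recip-difference (s m) (s n) (r m) (r n)) (cong₂ ℚ._-_
      (trans (cong (r m ℚ.*_) (sr≡1 n n≥)) (ℚₚ.*-identityʳ (r m)))
      (trans (cong (r n ℚ.*_) (sr≡1 m m≥)) (ℚₚ.*-identityʳ (r n)))))
    total : (κ ℚ.* κ) ℚ.* (δ ℚ.* δ ℚ.* ε) ≡ ε
    total = trans (regroup δ κ ε)
      (trans (cong (λ z → z ℚ.* z ℚ.* ε) δκ≡1) (ℚₚ.*-identityˡ ε))

_/_ : (x y : ℝ) {{_ : ApartFromZero y}} → ℝ
_/_ x y {{y#0}} = x * mkℝ (recip ∘ seq y) (recip-cauchy y y#0)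

-- ⌊√ k ⌋
isqrt : ℕ → ℕ
isqrt zero = 0
isqrt (suc k) with suc (isqrt k) ℕ.* suc (isqrt k) ℕₚ.≤? suc k
... | yes _ = suc (isqrt k)
... | no  _ = isqrt k

isqrt-lower : ∀ k → isqrt k ℕ.* isqrt k ℕ.≤ k
isqrt-lower zero = ℕ.z≤n
isqrt-lower (suc k) with suc (isqrt k) ℕ.* suc (isqrt k) ℕₚ.≤? suc k
... | yes le = le
... | no  _  = ℕₚ.m≤n⇒m≤1+n (isqrt-lower k)

isqrt-upper : ∀ k → k ℕ.< suc (isqrt k) ℕ.* suc (isqrt k)
isqrt-upper zero = ℕ.s≤s ℕ.z≤n
isqrt-upper (suc k) with suc (isqrt k) ℕ.* suc (isqrt k) ℕₚ.≤? suc k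
... | yes _  = ℕₚ.≤-<-trans (isqrt-upper k)
                 (ℕₚ.*-mono-< (ℕₚ.n<1+n (suc (isqrt k))) (ℕₚ.n<1+n (suc (isqrt k))))
... | no  gt = ℕₚ.≰⇒> gt

private
  sq-cancel-< : ∀ {m n} → m ℕ.* m ℕ.< n ℕ.* n → m ℕ.< n
  sq-cancel-< {m} {n} h with m ℕₚ.<? n
  ... | yes lt = lt
  ... | no  nl = contradiction (ℕₚ.*-mono-≤ (ℕₚ.≮⇒≥ nl) (ℕₚ.≮⇒≥ nl)) (ℕₚ.<⇒≱ h)

  /-≃ : ∀ a m → ℚ.toℚᵘ ((+ a) ℚ./ suc m) ℚᵘ.≃ mkℚᵘ (+ a) m
  /-≃ a m = ℚₚ.toℚᵘ-fromℚᵘ (mkℚᵘ (+ a) m)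

  /-mono-< : ∀ a m b n → a ℕ.* suc n ℕ.< b ℕ.* suc m → (+ a) ℚ./ suc m ℚ.< (+ b) ℚ./ suc n
  /-mono-< a m b n h = ℚₚ.toℚᵘ-cancel-<
    (ℚᵘₚ.<-respˡ-≃ (ℚᵘₚ.≃-sym (/-≃ a m)) (ℚᵘₚ.<-respʳ-≃ (ℚᵘₚ.≃-sym (/-≃ b n))
      (ℚᵘ.*<* (subst₂ ℤ._<_ (ℤₚ.pos-* a (suc n)) (ℤₚ.pos-* b (suc m)) (ℤ.+<+ h)))))

  /-mono-≤ : ∀ a m b n → a ℕ.* suc n ℕ.≤ b ℕ.* suc m → (+ a) ℚ./ suc m ℚ.≤ (+ b) ℚ./ suc n
  /-mono-≤ a m b n h = ℚₚ.toℚᵘ-cancel-≤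
    (ℚᵘₚ.≤-respˡ-≃ (ℚᵘₚ.≃-sym (/-≃ a m)) (ℚᵘₚ.≤-respʳ-≃ (ℚᵘₚ.≃-sym (/-≃ b n))
      (ℚᵘ.*≤* (subst₂ ℤ._≤_ (ℤₚ.pos-* a (suc n)) (ℤₚ.pos-* b (suc m)) (ℤ.+≤+ h)))))

  suc-/ : ∀ a m → (+ suc a) ℚ./ suc m ≡ (+ 1) ℚ./ suc m ℚ.+ (+ a) ℚ./ suc m
  suc-/ a m = ℚₚ.toℚᵘ-injective (ℚᵘₚ.≃-trans (/-≃ (suc a) m) (ℚᵘₚ.≃-sym
    (ℚᵘₚ.≃-trans (ℚₚ.toℚᵘ-homo-+ ((+ 1) ℚ./ suc m) ((+ a) ℚ./ suc m))
    (ℚᵘₚ.≃-trans (ℚᵘₚ.+-cong (/-≃ 1 m) (/-≃ a m)) (ℚᵘ.*≡* eq)))))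
    where
    natEq : ∀ a k → (1 ℕ.* k ℕ.+ a ℕ.* k) ℕ.* k ≡ (1 ℕ.+ a) ℕ.* (k ℕ.* k)
    natEq = solve-∀
    eq : ((+ 1) ℤ.* (+ suc m) ℤ.+ (+ a) ℤ.* (+ suc m)) ℤ.* (+ suc m)
         ≡ (+ suc a) ℤ.* (+ (suc m ℕ.* suc m))
    eq = trans (cong (ℤ._* (+ suc m)) (cong₂ ℤ._+_ (sym (ℤₚ.pos-* 1 (suc m))) (sym (ℤₚ.pos-* a (suc m)))))
      (trans (cong (ℤ._* (+ suc m)) (sym (ℤₚ.pos-+ (1 ℕ.* suc m) (a ℕ.* suc m))))
      (trans (sym (ℤₚ.pos-* (1 ℕ.* suc m ℕ.+ a ℕ.* suc m) (suc m)))
      (trans (cong +_ (natEq a (suc m))) (ℤₚ.pos-* (suc a) (suc m ℕ.* suc m)))))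

  archimedean : ∀ ε → 0ℚ ℚ.< ε → ∃[ N ] ((+ 1) ℚ./ suc N ℚ.≤ ε)
  archimedean (mkℚ (+ suc p) d cp) _ = d ,
    subst ((+ 1) ℚ./ suc d ℚ.≤_) (ℚₚ.↥p/↧p≡p (mkℚ (+ suc p) d cp))
      (/-mono-≤ 1 d (suc p) d (ℕₚ.*-monoˡ-≤ (suc d) {1} {suc p} (ℕ.s≤s ℕ.z≤n)))
  archimedean (mkℚ (+ 0) d cp) h with ℚ.positive h
  ... | ()
  archimedean (mkℚ ℤ.-[1+ p ] d cp) h with ℚ.positive h
  ... | ()

  ∣-∣-< : ∀ {a b z} → a ℚ.< z ℚ.+ b → b ℚ.< z ℚ.+ a → ∣ a ℚ.- b ∣ ℚ.< z
  ∣-∣-< {a} {b} {z} h k with ℚₚ.∣p∣≡p∨∣p∣≡-p (a ℚ.- b)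
  ... | inj₁ eq = subst₂ ℚ._<_ (sym eq) (add-sub z b) (ℚₚ.+-monoˡ-< (ℚ.- b) h)
  ... | inj₂ eq = subst₂ ℚ._<_ (sym (trans eq (neg-sub a b))) (add-sub z a) (ℚₚ.+-monoˡ-< (ℚ.- a) k)

-- With M = m + 1, the m-th approximation of √k is ⌊√(k M²)⌋ / M, which is
-- within 1/M of √k.
√-seq : ℕ → ℕ → ℚ
√-seq k m = (+ isqrt (k ℕ.* (suc m ℕ.* suc m))) ℚ./ suc m

private
  √-seq-< : ∀ k m n → √-seq k m ℚ.< (+ 1) ℚ./ suc n ℚ.+ √-seq k n
  √-seq-< k m n = subst (√-seq k m ℚ.<_) (suc-/ s n)
    (/-mono-< r m (suc s) n (sq-cancel-< (begin-strict
      (r ℕ.* N) ℕ.* (r ℕ.* N)             ≡⟨ shuffle₁ r N ⟩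
      (r ℕ.* r) ℕ.* (N ℕ.* N)             ≤⟨ ℕₚ.*-monoˡ-≤ (N ℕ.* N) (isqrt-lower (k ℕ.* (M ℕ.* M))) ⟩
      (k ℕ.* (M ℕ.* M)) ℕ.* (N ℕ.* N)     ≡⟨ shuffle₂ k M N ⟩
      (k ℕ.* (N ℕ.* N)) ℕ.* (M ℕ.* M)     <⟨ ℕₚ.*-monoˡ-< (M ℕ.* M) (isqrt-upper (k ℕ.* (N ℕ.* N))) ⟩
      (suc s ℕ.* suc s) ℕ.* (M ℕ.* M)     ≡⟨ sym (shuffle₁ (suc s) M) ⟩
      (suc s ℕ.* M) ℕ.* (suc s ℕ.* M)     ∎)))
    where
    open ℕₚ.≤-Reasoning
    M = suc m
    N = suc n
    r = isqrt (k ℕ.* (M ℕ.* M))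
    s = isqrt (k ℕ.* (N ℕ.* N))
    shuffle₁ : ∀ a b → (a ℕ.* b) ℕ.* (a ℕ.* b) ≡ (a ℕ.* a) ℕ.* (b ℕ.* b)
    shuffle₁ = solve-∀
    shuffle₂ : ∀ a b c → (a ℕ.* (b ℕ.* b)) ℕ.* (c ℕ.* c) ≡ (a ℕ.* (c ℕ.* c)) ℕ.* (b ℕ.* b)
    shuffle₂ = solve-∀

  √-cauchy : ∀ k → IsCauchy (√-seq k)
  √-cauchy k ε ε>0 with archimedean ε ε>0
  ... | N , h = N , λ m n m≥ n≥ → ∣-∣-<
      (ℚₚ.<-≤-trans (√-seq-< k m n) (ℚₚ.+-monoˡ-≤ (√-seq k n) (small n n≥)))
      (ℚₚ.<-≤-trans (√-seq-< k n m) (ℚₚ.+-monoˡ-≤ (√-seq k m) (small m m≥)))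
    where
    small : ∀ n → N ℕ.≤ n → (+ 1) ℚ./ suc n ℚ.≤ ε
    small n n≥ = ℚₚ.≤-trans (/-mono-≤ 1 n 1 N (ℕₚ.*-monoʳ-≤ 1 (ℕ.s≤s n≥))) h

infix 9 √_

√_ : ℕ → ℝ
√ k = mkℝ (√-seq k) (√-cauchy k)

instance
  √2#0 : ApartFromZero (√ 2)
  √2#0 = record
    { δ     = 1ℚ
    ; δ>0   = ℚₚ.positive⁻¹ 1ℚ
    ; start = 0
    ; bound = λ m _ → ℚₚ.≤-trans (1≤ m) (ℚₚ.≤-reflexive (sym (ℚₚ.0≤p⇒∣p∣≡p
                (ℚₚ.≤-trans (ℚₚ.<⇒≤ (ℚₚ.positive⁻¹ 1ℚ)) (1≤ m)))))
    }
    where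
    1≤ : ∀ m → 1ℚ ℚ.≤ √-seq 2 m
    1≤ m = /-mono-≤ 1 0 (isqrt (2 ℕ.* (suc m ℕ.* suc m))) m
      (subst₂ ℕ._≤_ (sym (ℕₚ.*-identityˡ (suc m))) (sym (ℕₚ.*-identityʳ (isqrt K)))
        (ℕₚ.≤-pred (sq-cancel-< {suc m} {suc (isqrt K)}
          (ℕₚ.≤-<-trans (ℕₚ.m≤n*m (suc m ℕ.* suc m) 2) (isqrt-upper K)))))
      where
      K : ℕ
      K = 2 ℕ.* (suc m ℕ.* suc m)

sumℝ : {A : Set a} → (A → ℝ) → List A → ℝ
sumℝ f = foldr (λ x acc → f x + acc) 0ℝ

------------------------------------------------------------------------
-- Finite sets (setoids enumerated by Fin n, so of cardinality n)

Enumeration : Setoid c ℓ → ℕ → Set (c ⊔ ℓ)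
Enumeration S n = Inverse S (≡.setoid (Fin n))

module Finite {S : Setoid c ℓ} {n : ℕ} (enum : Enumeration S n) where
  open Setoid S renaming (sym to ≈-sym; trans to ≈-trans)
  open Inverse enum

  element : Fin n → Carrier
  element = from

  card : {P : Pred Carrier p} → Unary.Decidable P → ℕ
  card P? = length (filter (λ i → P? (element i)) (allFin n))

  infix 4 _≈?_
  _≈?_ : Decidable _≈_
  x ≈? y = map′
    (λ eq → ≈-trans (≈-sym (strictlyInverseʳ x)) (≈-trans (from-cong eq) (strictlyInverseʳ y)))
    to-cong
    (to x ≟ᶠ to y)

  any? : {P : Pred Carrier p} → P Respects _≈_ → Unary.Decidable P → Dec (∃ P)
  any? resp P? = map′
    (λ (i , Pi) → element i , Pi)
    (λ (x , Px) → to x , resp (≈-sym (strictlyInverseʳ x)) Px)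
    (anyᶠ? (λ i → P? (element i)))

------------------------------------------------------------------------
-- Finite simple graphs and the Sombor index

record FiniteSimpleGraph (v e a : Level) : Set (lsuc (v ⊔ e ⊔ a)) where
  field
    vertices    : Setoid v e
    order       : ℕ
    enumeration : Enumeration vertices order

  open Setoid vertices public using () renaming (Carrier to Vertex; _≈_ to _≈ᵥ_)

  field
    Adjacent        : Rel Vertex a
    adjacent?       : Decidable Adjacent
    adjacent-resp   : Adjacent Respects₂ _≈ᵥ_
    adjacent-sym    : Symmetric Adjacent
    adjacent-irrefl : ∀ {x y} → x ≈ᵥ y → ¬ Adjacent x y

  open Finite enumeration using (element; card)

  degree : Vertex → ℕ
  degree x = card (adjacent? x)

  -- Each unordered edge is listed once, with its endpoints in increasing
  -- order of index.
  edges : List (Vertex × Vertex)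
  edges = List.map (λ (i , j) → element i , element j)
    (filter (λ (i , j) → (i <ᶠ? j) ×-dec adjacent? (element i) (element j))
      (cartesianProduct (allFin order) (allFin order)))

  SO : ℝ
  SO = sumℝ (λ (x , y) → √ (degree x ℕ.^ 2 ℕ.+ degree y ℕ.^ 2)) edges

open FiniteSimpleGraph public using (SO)

------------------------------------------------------------------------
-- Commutative rings

module _ (R : CommutativeRing c ℓ) where
  private module R = CommutativeRing R

  2# : R.Carrier
  2# = R.1# R.+ R.1#

  IsUnit : Pred R.Carrier (c ⊔ ℓ)
  IsUnit x = Invertible R._≈_ R.1# R._*_ x

  -- 0 is put in explicitly so that it is a member even of Z(0).
  Z : Pred R.Carrier (c ⊔ ℓ)
  Z x = x R.≈ R.0# ⊎ ∃[ y ] (¬ y R.≈ R.0# × x R.* y R.≈ R.0#)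

  record IsIdeal (I : Pred R.Carrier p) : Set (c ⊔ ℓ ⊔ p) where
    field
      resp     : I Respects R._≈_
      0∈       : R.0# ∈ I
      +-closed : ∀ {x y} → x ∈ I → y ∈ I → (x R.+ y) ∈ I
      *-absorb : ∀ r {x} → x ∈ I → (r R.* x) ∈ I

  record IsProperIdeal (I : Pred R.Carrier p) : Set (c ⊔ ℓ ⊔ p) where
    field
      isIdeal : IsIdeal I
      proper  : ¬ (∀ x → x ∈ I)

  record IsMaximalIdeal (I : Pred R.Carrier (c ⊔ ℓ)) : Set (lsuc (c ⊔ ℓ)) where
    field
      isProperIdeal : IsProperIdeal I
      maximal       : ∀ (J : Pred R.Carrier (c ⊔ ℓ)) → IsProperIdeal J → I ⊆ J → J ⊆ I

  -- Exactly one maximal ideal; the zero ring has none, so it is not local.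
  IsLocal : Set (lsuc (c ⊔ ℓ))
  IsLocal = ∃! _≐_ IsMaximalIdeal

module _ (R : CommutativeRing c ℓ) {n : ℕ}
         (enum : Enumeration (CommutativeRing.setoid R) n) where
  private module R = CommutativeRing R
  open Finite enum

  isUnit? : Unary.Decidable (IsUnit R)
  isUnit? x = any?
    (λ y≈z (yx , xy) → R.trans (R.*-congʳ (R.sym y≈z)) yx , R.trans (R.*-congˡ (R.sym y≈z)) xy)
    (λ y → (y R.* x ≈? R.1#) ×-dec (x R.* y ≈? R.1#))

  Z? : Unary.Decidable (Z R)
  Z? x = (x ≈? R.0#) ⊎-dec any?
    (λ y≈z (y≉0 , xy≈0) → (λ z≈0 → y≉0 (R.trans y≈z z≈0)) , R.trans (R.*-congˡ (R.sym y≈z)) xy≈0)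
    (λ y → ¬? (y ≈? R.0#) ×-dec (x R.* y ≈? R.0#))

  ∣U∣ : ℕ
  ∣U∣ = card isUnit?

  totalGraph : FiniteSimpleGraph c ℓ (c ⊔ ℓ)
  totalGraph = record
    { vertices        = R.setoid
    ; order           = n
    ; enumeration     = enum
    ; Adjacent        = λ x y → ¬ (x R.≈ y) × (x R.+ y) ∈ Z R
    ; adjacent?       = λ x y → ¬? (x ≈? y) ×-dec Z? (x R.+ y)
    ; adjacent-resp   =
        (λ y≈z (x≉y , z) → (λ x≈z → x≉y (R.trans x≈z (R.sym y≈z))) , Z-resp (R.+-congˡ y≈z) z) ,
        (λ y≈z (y≉x , z) → (λ z≈x → y≉x (R.trans y≈z z≈x)) , Z-resp (R.+-congʳ y≈z) z)
    ; adjacent-sym    = λ {x} {y} (x≉y , z) → (x≉y ∘ R.sym) , Z-resp (R.+-comm x y) z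
    ; adjacent-irrefl = λ x≈y (x≉y , _) → x≉y x≈y
    }
    where
    Z-resp : Z R Respects R._≈_
    Z-resp x≈y = Sum.map (R.trans (R.sym x≈y))
      (λ (w , w≉0 , xw≈0) → w , w≉0 , R.trans (R.*-congʳ (R.sym x≈y)) xw≈0)

{-# OPTIONS --safe #-}
module Submission where

-- In a finite commutative ring the zero-divisors are exactly the nonunits, and every nonunit
-- lies in a maximal ideal; so if R is local, Z(R) is an ideal, of cardinality z = n - |U(R)|.
-- Translation by x shows that x has z neighbours, minus 1 if 2x ∈ Z(R). Since
-- 2y = 2(x + y) - 2x, adjacent vertices have the same degree, so each edge xy contributes
-- √2 d_x to SO and, by the handshake argument, SO = (Σ_x d_x²) / √2. If 2 is not a unit,
-- all degrees are z - 1; if it is, the degree is z - 1 on Z(R) and z on U(R).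

open import Defs using (ℝ; seq; _≃_; _/_; √_; √-seq; fromℕ; sumℝ; isqrt; isqrt-lower; isqrt-upper; recip)
open import Defs using (Enumeration; module Finite; FiniteSimpleGraph; module FiniteSimpleGraph; SO)
open import Defs using (2#; IsUnit; Z; IsIdeal; IsProperIdeal; IsMaximalIdeal; IsLocal; isUnit?; Z?; ∣U∣; totalGraph)
open import Algebra.Bundles using (CommutativeMonoid; CommutativeRing)
open import Data.Bool.Base using (if_then_else_)
open import Data.Fin.Base using (Fin; zero; suc; toℕ)
open import Data.Fin.Permutation using (permutation)
import Data.Fin.Properties as Finₚ
open import Data.Integer.Base as ℤ using (-[1+_])
import Data.Integer.Properties as ℤₚ
open import Data.List.Base as List using (List; []; _∷_; _++_; allFin; cartesianProduct; filter; length; tabulate)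
open import Data.List.Membership.Propositional.Properties using (∈-allFin)
import Data.List.Properties as Listₚ
open import Data.List.Relation.Unary.All as All using (All; []; _∷_)
import Data.List.Relation.Unary.All.Properties as Allₚ
open import Data.Nat.Base as ℕ using (ℕ; zero; suc; z≤n; s≤s)
import Data.Nat.ListAction as ListAction
open import Data.Nat.ListAction.Properties using (sum-++)
import Data.Nat.Properties as ℕₚ
open import Data.Nat.Tactic.RingSolver using (solve-∀)
open import Data.Product.Base using (∃-syntax; Σ-syntax; _×_; _,_; proj₂)
open import Data.Rational.Base as ℚ using (ℚ; mkℚ; 0ℚ; 1ℚ; ∣_∣)
import Data.Rational.Properties as ℚₚ
open import Data.Rational.Unnormalised.Base as ℚᵘ using (mkℚᵘ)
import Data.Rational.Unnormalised.Properties as ℚᵘₚ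
open import Data.Sum.Base using (_⊎_; inj₁; inj₂)
open import Function.Base using (_∘_; id; case_of_)
open import Function.Bundles using (Inverse)
open import Level using (Level; _⊔_)
open import Relation.Binary.Bundles using (Setoid)
open import Relation.Binary.Definitions using (tri<; tri≈; tri>)
open import Relation.Binary.PropositionalEquality as ≡
  using (_≡_; _≢_; cong; cong₂; subst; subst₂; module ≡-Reasoning)
open import Relation.Nullary.Decidable using (Dec; does; yes; no; _×-dec_)
open import Relation.Nullary.Negation using (¬_; contradiction)
open import Relation.Unary using (Pred; Decidable; _∈_; _⊆_)
open import Algebra.Properties.AbelianGroup ℚₚ.+-0-abelianGroup using (xyx⁻¹≈y; ⁻¹-anti-homo-//)
open import Algebra.Properties.Semiring.Sum ℕₚ.+-*-semiring
  using (sum; sum-syntax; sum-cong-≗; sum-permute; ∑-comm; ∑-distrib-+; *-distribʳ-sum)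

-- A maximal ideal above a given nonunit has to be constructed: the elements of R are scanned once,
-- each being adjoined unless that would bring in 1, a question settled by search through the
-- enumeration. On the analytic side the two members of the formula are different Cauchy sequences.
-- With M = m + 1, the left one adds fractions ⌊√(2d²M²)⌋/M, while the right one divides by
-- ⌊√(2M²)⌋/M. They agree only in the limit, so both are trapped in an interval of width O(1/M) by
-- inequalities between natural numbers. If D is the sum of d over the edges, √2 D is handled
-- throughout as 2D/√2, because the formula to be reached has √2 in the denominator.

private variable
  a p q : Level
  A B : Set a

-- Ideals, units and zero-divisors

module _ {c ℓ} (R : CommutativeRing c ℓ) where
  open CommutativeRing R hiding (zero)
  open import Algebra.Properties.Ring ring
    using (x∙y⁻¹≈ε⇒x≈y; -1*x≈-x; x[y-z]≈xy-xz)
  open import Algebra.Solver.Ring.NaturalCoefficients.Default commutativeSemiring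
  open import Relation.Binary.Reasoning.Setoid setoid

  +-cancel-multiple : ∀ x r y → (x + r * y) + - r * y ≈ x
  +-cancel-multiple x r y = begin
    (x + r * y) + - r * y   ≈⟨ +-assoc x (r * y) (- r * y) ⟩
    x + (r * y + - r * y)   ≈⟨ +-congˡ (distribʳ y r (- r)) ⟨
    x + (r + - r) * y       ≈⟨ +-congˡ (*-congʳ (-‿inverseʳ r)) ⟩
    x + 0# * y              ≈⟨ +-congˡ (zeroˡ y) ⟩
    x + 0#                  ≈⟨ +-identityʳ x ⟩
    x                       ∎

  module Ideal {p} {I : Pred Carrier p} (ideal : IsIdeal R I) where
    open IsIdeal ideal public

    cancel-multiple : ∀ {x} r {y} → x + r * y ∈ I → y ∈ I → x ∈ I
    cancel-multiple {x} r {y} x+ry∈I y∈I =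
      resp (+-cancel-multiple x r y) (+-closed x+ry∈I (*-absorb (- r) y∈I))

    +-cancelˡ : ∀ {x y} → x + y ∈ I → x ∈ I → y ∈ I
    +-cancelˡ {x} {y} x+y∈I x∈I = cancel-multiple 1#
      (resp (trans (+-comm x y) (+-congˡ (sym (*-identityˡ x)))) x+y∈I) x∈I

    1∈⇒all : 1# ∈ I → ∀ x → x ∈ I
    1∈⇒all 1∈I x = resp (*-identityʳ x) (*-absorb x 1∈I)

    unit∈⇒all : ∀ {u} → IsUnit R u → u ∈ I → ∀ x → x ∈ I
    unit∈⇒all (v , vu≈1 , _) u∈I = 1∈⇒all (resp vu≈1 (*-absorb v u∈I))

  -- The ideal I + Re. Only the coefficient of e is quantified, so that membership is decidable by a
  -- search over r when I is decidable. Adjoining an element to the zero ideal lands at level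
  -- `c ⊔ ℓ`, where `IsMaximalIdeal` lives, and further adjunctions stay there.
  _+⟨_⟩ : ∀ {p} → Pred Carrier p → Carrier → Pred Carrier (c ⊔ p)
  (I +⟨ e ⟩) y = ∃[ r ] y + r * e ∈ I

  +⟨⟩-mono : ∀ {p q} {I : Pred Carrier p} {J : Pred Carrier q} {e} → I ⊆ J → I +⟨ e ⟩ ⊆ J +⟨ e ⟩
  +⟨⟩-mono I⊆J (r , y+re∈I) = r , I⊆J y+re∈I

  module _ {p} {I : Pred Carrier p} (ideal : IsIdeal R I) (e : Carrier) where
    open Ideal ideal

    ⊆-+⟨⟩ : I ⊆ I +⟨ e ⟩
    ⊆-+⟨⟩ {y} y∈I = 0# , resp (sym (trans (+-congˡ (zeroˡ e)) (+-identityʳ y))) y∈I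

    ∈-+⟨⟩ : e ∈ I +⟨ e ⟩
    ∈-+⟨⟩ = - 1# , resp (sym (trans (+-congˡ (-1*x≈-x e)) (-‿inverseʳ e))) 0∈

    +⟨⟩-isIdeal : IsIdeal R (I +⟨ e ⟩)
    +⟨⟩-isIdeal = record
      { resp     = λ { x≈y (r , x+re∈I) → r , resp (+-congʳ x≈y) x+re∈I }
      ; 0∈       = ⊆-+⟨⟩ 0∈
      ; +-closed = λ { {x} {y} (r , x+re∈I) (s , y+se∈I) → r + s , resp
          (solve 5 (λ x y r s e → (x :+ r :* e) :+ (y :+ s :* e) := (x :+ y) :+ (r :+ s) :* e)
            refl x y r s e)
          (+-closed x+re∈I y+se∈I) }
      ; *-absorb = λ { t {x} (r , x+re∈I) → t * r , resp
          (solve 4 (λ t x r e → t :* (x :+ r :* e) := t :* x :+ (t :* r) :* e) refl t x r e)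
          (*-absorb t x+re∈I) }
      }

  zeroIdeal : IsIdeal R (_≈ 0#)
  zeroIdeal = record
    { resp     = λ x≈y x≈0 → trans (sym x≈y) x≈0
    ; 0∈       = refl
    ; +-closed = λ x≈0 y≈0 → trans (+-cong x≈0 y≈0) (+-identityʳ 0#)
    ; *-absorb = λ r x≈0 → trans (*-congˡ x≈0) (zeroʳ r)
    }

  nonunit⇒principal-proper : ∀ {x} → ¬ IsUnit R x → IsProperIdeal R ((_≈ 0#) +⟨ x ⟩)
  nonunit⇒principal-proper {x} nonunit = record
    { isIdeal = +⟨⟩-isIdeal zeroIdeal x
    ; proper  = λ all → nonunit (invert (all 1#))
    }
    where
    invert : 1# ∈ (_≈ 0#) +⟨ x ⟩ → IsUnit R x
    -- Membership of 1 reads 1 + rx = 0 in this sign convention, hence the inverse - r.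
    invert (r , 1+rx≈0) = - r , -rx≈1 , trans (*-comm x (- r)) -rx≈1
      where
      -rx≈1 : - r * x ≈ 1#
      -rx≈1 = begin
        - r * x                  ≈⟨ +-identityˡ (- r * x) ⟨
        0# + - r * x             ≈⟨ +-congʳ 1+rx≈0 ⟨
        (1# + r * x) + - r * x   ≈⟨ +-cancel-multiple 1# r x ⟩
        1#                       ∎

  unit⇒¬Z : ¬ 1# ≈ 0# → ∀ {x} → IsUnit R x → ¬ x ∈ Z R
  unit⇒¬Z 1≉0 {x} (v , vx≈1 , _) (inj₁ x≈0) =
    1≉0 (trans (sym vx≈1) (trans (*-congˡ x≈0) (zeroʳ v)))
  unit⇒¬Z 1≉0 {x} (v , vx≈1 , _) (inj₂ (y , y≉0 , xy≈0)) = y≉0 (begin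
    y             ≈⟨ *-identityˡ y ⟨
    1# * y        ≈⟨ *-congʳ vx≈1 ⟨
    (v * x) * y   ≈⟨ *-assoc v x y ⟩
    v * (x * y)   ≈⟨ *-congˡ xy≈0 ⟩
    v * 0#        ≈⟨ zeroʳ v ⟩
    0#            ∎)

  proper⇒1≉0 : ∀ {p} {I : Pred Carrier p} → IsProperIdeal R I → ¬ 1# ≈ 0#
  proper⇒1≉0 record { isIdeal = ideal ; proper = proper } 1≈0 =
    proper (1∈⇒all (resp (sym 1≈0) 0∈))
    where open Ideal ideal

  -- Zero-divisors and maximal ideals of a finite ring

  module _ {n} (enum : Enumeration setoid n) where
    open Finite enum
    open Inverse enum using (to; to-cong; strictlyInverseʳ; strictlyInverseˡ)

    -- By pigeonhole, one of 1, x e₁, …, x eₙ repeats: either x is invertible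
    -- or x(eᵢ - eⱼ) = 0.
    nonunit⇒Z : ∀ {x} → ¬ IsUnit R x → x ∈ Z R
    nonunit⇒Z {x} nonunit = collision (Finₚ.pigeonhole (ℕₚ.n<1+n n) hole)
      where
      value : Fin (ℕ.suc n) → Carrier
      value zero    = 1#
      value (suc i) = x * element i

      hole : Fin (ℕ.suc n) → Fin n
      hole i = to (value i)

      value-injective : ∀ i j → hole i ≡ hole j → value i ≈ value j
      value-injective i j eq = trans (sym (strictlyInverseʳ (value i)))
        (trans (reflexive (≡.cong element eq)) (strictlyInverseʳ (value j)))

      element-injective : ∀ i j → element i ≈ element j → i ≡ j
      element-injective i j eq = ≡.trans
        (≡.sym (strictlyInverseˡ i))
        (≡.trans (to-cong eq) (strictlyInverseˡ j))

      collision : (∃[ i ] ∃[ j ] (toℕ i ℕ.< toℕ j × hole i ≡ hole j)) → x ∈ Z R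
      collision (zero , suc j , _ , eq) = contradiction
        (element j , trans (*-comm (element j) x) xe≈1 , xe≈1) nonunit
        where xe≈1 = sym (value-injective zero (suc j) eq)
      collision (suc i , suc j , s≤s i<j , eq) = inj₂ (element i - element j , y≉0 , (begin
        x * (element i - element j)       ≈⟨ x[y-z]≈xy-xz x (element i) (element j) ⟩
        x * element i - x * element j     ≈⟨ +-congʳ (value-injective (suc i) (suc j) eq) ⟩
        x * element j - x * element j     ≈⟨ -‿inverseʳ (x * element j) ⟩
        0#                                ∎))
        where
        y≉0 : ¬ element i - element j ≈ 0#
        y≉0 y≈0 = ℕₚ.<⇒≢ i<j (≡.cong toℕ
          (element-injective i j (x∙y⁻¹≈ε⇒x≈y (element i) (element j) y≈0)))

    +⟨⟩? : ∀ {p} {I : Pred Carrier p} → IsIdeal R I → Decidable I → ∀ e → Decidable (I +⟨ e ⟩)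
    +⟨⟩? ideal I? e y = any? (λ r≈s → resp (+-congˡ (*-congʳ r≈s))) (λ r → I? (y + r * e))
      where open IsIdeal ideal

    -- Maximality tested at a single element. Both alternatives persist when J grows, so a decision
    -- made early in the scan stays valid for the final ideal.
    _SaturatedAt_ : ∀ {p} → Pred Carrier p → Carrier → Set (c ⊔ p)
    J SaturatedAt e = e ∈ J ⊎ 1# ∈ J +⟨ e ⟩

    -- A finite substitute for Zorn's lemma. If 1 lies in I + Re, then e is skipped and this witness
    -- is carried up to J; otherwise I + Re is itself proper and replaces I.
    saturate : (es : List Carrier) (I : Pred Carrier (c ⊔ ℓ)) → IsProperIdeal R I → Decidable I →
      Σ[ J ∈ Pred Carrier (c ⊔ ℓ) ] (IsProperIdeal R J × I ⊆ J × All (J SaturatedAt_) es)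
    saturate [] I proper I? = I , proper , (λ y∈I → y∈I) , []
    saturate (e ∷ es) I record { isIdeal = ideal ; proper = proper } I?
      with +⟨⟩? ideal I? e 1#
    ... | yes 1∈ with saturate es I (record { isIdeal = ideal ; proper = proper }) I?
    ...   | J , J-proper , I⊆J , sat = J , J-proper , I⊆J , inj₂ (+⟨⟩-mono {I = I} {J} I⊆J {1#} 1∈) ∷ sat
    saturate (e ∷ es) I record { isIdeal = ideal ; proper = proper } I?
        | no 1∉ with saturate es (I +⟨ e ⟩)
                       (record { isIdeal = +⟨⟩-isIdeal ideal e ; proper = λ all → 1∉ (all 1#) })
                       (+⟨⟩? ideal I? e)
    ...   | J , J-proper , I+e⊆J , sat =
            J , J-proper , (λ y∈I → I+e⊆J (⊆-+⟨⟩ ideal e y∈I)) , inj₁ (I+e⊆J (∈-+⟨⟩ ideal e)) ∷ sat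

    -- Let K ⊇ J be proper and k ∈ K. If k were not already in J, some 1 + rk would lie in J ⊆ K,
    -- forcing 1 ∈ K. Saturation is known at enumerated elements only, so k is first replaced by its
    -- representative.
    saturated⇒maximal : {J : Pred Carrier (c ⊔ ℓ)} → IsProperIdeal R J →
      (∀ i → J SaturatedAt element i) → IsMaximalIdeal R J
    saturated⇒maximal {J} J-proper sat = record
      { isProperIdeal = J-proper
      ; maximal       = λ K K-proper J⊆K {k} k∈K →
          let open IsProperIdeal K-proper using (proper) renaming (isIdeal to K-ideal)
              module K = Ideal K-ideal
              k≈ = strictlyInverseʳ k
          in J.resp k≈ (case sat (to k) of λ
               { (inj₁ k∈J)        → k∈J
               ; (inj₂ (r , 1+∈J)) → contradiction
                   (K.1∈⇒all (K.cancel-multiple r (J⊆K 1+∈J) (K.resp (sym k≈) k∈K))) proper })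
      }
      where
      module J = Ideal (IsProperIdeal.isIdeal J-proper)

    nonunit⇒∈maximal : ∀ {x} → ¬ IsUnit R x → ∃[ J ] (IsMaximalIdeal R J × x ∈ J)
    nonunit⇒∈maximal {x} nonunit
      with saturate (List.map element (allFin n)) ((_≈ 0#) +⟨ x ⟩) (nonunit⇒principal-proper nonunit)
             (+⟨⟩? zeroIdeal (_≈? 0#) x)
    ... | J , J-proper , x⊆J , sat =
      J , saturated⇒maximal J-proper (λ i → All.lookup (Allₚ.map⁻ sat) (∈-allFin i)) , x⊆J (∈-+⟨⟩ zeroIdeal x)

    -- `Z R` has the same elements as M, and the ideal axioms are carried along the two inclusions.
    -- Uniqueness of M enters in `Z⊆M`: the maximal ideal built around a zero-divisor must be M.
    local⇒Z-proper : IsLocal R → IsProperIdeal R (Z R)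
    local⇒Z-proper (M , M-max , unique) = record
      { isIdeal = record
          { resp     = λ x≈y x∈Z → M⊆Z (resp x≈y (Z⊆M x∈Z))
          ; 0∈       = M⊆Z 0∈
          ; +-closed = λ x∈Z y∈Z → M⊆Z (+-closed (Z⊆M x∈Z) (Z⊆M y∈Z))
          ; *-absorb = λ r x∈Z → M⊆Z (*-absorb r (Z⊆M x∈Z))
          }
      ; proper  = λ all → proper (λ x → Z⊆M (all x))
      }
      where
      open IsProperIdeal (IsMaximalIdeal.isProperIdeal M-max)
      open Ideal isIdeal

      M⊆Z : M ⊆ Z R
      M⊆Z x∈M = nonunit⇒Z (λ unit → proper (unit∈⇒all unit x∈M))

      Z⊆M : Z R ⊆ M
      Z⊆M x∈Z with nonunit⇒∈maximal
        (λ unit → unit⇒¬Z (proper⇒1≉0 (IsMaximalIdeal.isProperIdeal M-max)) unit x∈Z)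
      ... | J , J-max , x∈J with unique J-max
      ...   | _ , J⊆M = J⊆M x∈J

-- Indicators and finite sums of natural numbers

module _ where
  open import Data.Nat.Base using (_+_; _*_)
  open ≡ using (refl; sym; trans)

  𝟙 : {P : Set p} → Dec P → ℕ
  𝟙 P? = if does P? then 1 else 0

  𝟙-yes : {P : Set p} (P? : Dec P) → P → 𝟙 P? ≡ 1
  𝟙-yes (yes _) _  = refl
  𝟙-yes (no ¬P) P = contradiction P ¬P

  𝟙-no : {P : Set p} (P? : Dec P) → ¬ P → 𝟙 P? ≡ 0
  𝟙-no (yes P) ¬P = contradiction P ¬P
  𝟙-no (no _)  _  = refl

  𝟙-cong : {P : Set p} {Q : Set q} (P? : Dec P) (Q? : Dec Q) → (P → Q) → (Q → P) → 𝟙 P? ≡ 𝟙 Q?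
  𝟙-cong (yes P) Q? P⇒Q Q⇒P = sym (𝟙-yes Q? (P⇒Q P))
  𝟙-cong (no ¬P) Q? P⇒Q Q⇒P = sym (𝟙-no Q? (¬P ∘ Q⇒P))

  𝟙-complement : {P : Set p} {Q : Set q} (P? : Dec P) (Q? : Dec Q) → (P → ¬ Q) → (¬ Q → P) → 𝟙 P? + 𝟙 Q? ≡ 1
  𝟙-complement (yes P) Q?     P⇒¬Q ¬Q⇒P = cong ℕ.suc (𝟙-no Q? (P⇒¬Q P))
  𝟙-complement (no ¬P) (yes _) P⇒¬Q ¬Q⇒P = refl
  𝟙-complement (no ¬P) (no ¬Q) P⇒¬Q ¬Q⇒P = contradiction (¬Q⇒P ¬Q) ¬P

  sumOver : (A → ℕ) → List A → ℕ
  sumOver f xs = ListAction.sum (List.map f xs)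

  sumOver-++ : (f : A → ℕ) (xs ys : List A) → sumOver f (xs ++ ys) ≡ sumOver f xs + sumOver f ys
  sumOver-++ f xs ys = trans (cong ListAction.sum (Listₚ.map-++ f xs ys)) (sum-++ (List.map f xs) (List.map f ys))

  sumOver-map : (f : B → ℕ) (g : A → B) (xs : List A) → sumOver f (List.map g xs) ≡ sumOver (f ∘ g) xs
  sumOver-map f g xs = cong ListAction.sum (sym (Listₚ.map-∘ xs))

  sumOver-filter : {P : Pred A p} (P? : Decidable P) (f : A → ℕ) (xs : List A) →
    sumOver f (filter P? xs) ≡ sumOver (λ x → 𝟙 (P? x) * f x) xs
  sumOver-filter P? f [] = refl
  sumOver-filter P? f (x ∷ xs) with P? x
  ... | yes _ = cong₂ _+_ (sym (ℕₚ.+-identityʳ (f x))) (sumOver-filter P? f xs)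
  ... | no _  = sumOver-filter P? f xs

  length-filter : {P : Pred A p} (P? : Decidable P) (xs : List A) →
    length (filter P? xs) ≡ sumOver (𝟙 ∘ P?) xs
  length-filter P? [] = refl
  length-filter P? (x ∷ xs) with P? x
  ... | yes _ = cong ℕ.suc (length-filter P? xs)
  ... | no _  = length-filter P? xs

  sumOver-tabulate : ∀ {n} (f : A → ℕ) (g : Fin n → A) → sumOver f (tabulate g) ≡ ∑[ i < n ] f (g i)
  sumOver-tabulate {n = ℕ.zero}  f g = refl
  sumOver-tabulate {n = ℕ.suc n} f g = cong (f (g zero) +_) (sumOver-tabulate f (g ∘ suc))

  sumOver-cartesianProduct : (f : A × B → ℕ) (xs : List A) (ys : List B) →
    sumOver f (cartesianProduct xs ys) ≡ sumOver (λ x → sumOver (λ y → f (x , y)) ys) xs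
  sumOver-cartesianProduct f [] ys = refl
  sumOver-cartesianProduct f (x ∷ xs) ys = trans
    (sumOver-++ f (List.map (x ,_) ys) (cartesianProduct xs ys))
    (cong₂ _+_ (sumOver-map f (x ,_) ys) (sumOver-cartesianProduct f xs ys))

  sumOver-cartesianProduct-allFin : ∀ {m n} (f : Fin m × Fin n → ℕ) →
    sumOver f (cartesianProduct (allFin m) (allFin n)) ≡ ∑[ i < m ] ∑[ j < n ] f (i , j)
  sumOver-cartesianProduct-allFin {m} {n} f = trans
    (sumOver-cartesianProduct f (allFin m) (allFin n))
    (trans (sumOver-tabulate (λ i → sumOver (λ j → f (i , j)) (allFin n)) id)
      (sum-cong-≗ (λ i → sumOver-tabulate (λ j → f (i , j)) id)))

  sum-const : ∀ n x → ∑[ i < n ] x ≡ n * x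
  sum-const ℕ.zero    x = refl
  sum-const (ℕ.suc n) x = cong (x +_) (sum-const n x)

  -- Meant for neighbour counts, where adjacency to x agrees with a condition on the sum except at x
  -- itself. The additive form avoids truncated subtraction.
  sum-delete : ∀ {n} (f g : Fin n → ℕ) i → f i ≡ 0 → (∀ j → i ≢ j → f j ≡ g j) →
    sum f + g i ≡ sum g
  sum-delete f g zero fᵢ≡0 f≡g = begin
    f zero + sum (f ∘ suc) + g zero   ≡⟨ cong (λ t → t + sum (f ∘ suc) + g zero) fᵢ≡0 ⟩
    sum (f ∘ suc) + g zero            ≡⟨ ℕₚ.+-comm (sum (f ∘ suc)) (g zero) ⟩
    g zero + sum (f ∘ suc)            ≡⟨ cong (g zero +_) (sum-cong-≗ (λ j → f≡g (suc j) λ ())) ⟩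
    g zero + sum (g ∘ suc)            ∎
    where open ≡-Reasoning
  sum-delete f g (suc i) fᵢ≡0 f≡g = trans
    (ℕₚ.+-assoc (f zero) (sum (f ∘ suc)) (g (suc i)))
    (cong₂ _+_ (f≡g zero λ ())
      (sum-delete (f ∘ suc) (g ∘ suc) i fᵢ≡0 (λ j i≢j → f≡g (suc j) (i≢j ∘ Finₚ.suc-injective))))

-- Degrees and edge sums in a finite simple graph

module _ {v e a} (G : FiniteSimpleGraph v e a) where
  open import Data.Nat.Base using (_+_; _*_; _<_)
  open ≡ using (refl; sym; trans)

  open FiniteSimpleGraph G
  open Finite enumeration using (element)

  degree-sum : ∀ x → degree x ≡ ∑[ i < order ] 𝟙 (adjacent? x (element i))
  degree-sum x = trans (length-filter (λ i → adjacent? x (element i)) (allFin order))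
    (sumOver-tabulate (λ i → 𝟙 (adjacent? x (element i))) id)

  edges-adjacent : All (λ (x , y) → Adjacent x y) edges
  edges-adjacent = Allₚ.map⁺ (All.map proj₂ (Allₚ.all-filter
    (λ (i , j) → (i Finₚ.<? j) ×-dec adjacent? (element i) (element j))
    (cartesianProduct (allFin order) (allFin order))))

  -- `edges` keeps only pairs with i < j. Exchanging the order of summation in the part weighted by
  -- the second endpoint puts the weight on i in both parts, and `β i j + β j i` is the full
  -- adjacency indicator, whose row sums are the degrees.
  handshake : (w : Vertex → ℕ) →
    sumOver (λ (x , y) → w x + w y) edges ≡ ∑[ i < order ] (degree (element i) * w (element i))
  handshake w = begin
    sumOver (λ (x , y) → w x + w y) edges
      ≡⟨ sumOver-map (λ (x , y) → w x + w y) (λ (i , j) → element i , element j)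
           (filter edge? pairs) ⟩
    sumOver (λ (i , j) → w′ i + w′ j) (filter edge? pairs)
      ≡⟨ sumOver-filter edge? (λ (i , j) → w′ i + w′ j) pairs ⟩
    sumOver (λ (i , j) → β i j * (w′ i + w′ j)) pairs
      ≡⟨ sumOver-cartesianProduct-allFin (λ (i , j) → β i j * (w′ i + w′ j)) ⟩
    (∑[ i < order ] ∑[ j < order ] (β i j * (w′ i + w′ j)))
      ≡⟨ ∑∑-cong (λ i j → ℕₚ.*-distribˡ-+ (β i j) (w′ i) (w′ j)) ⟩
    (∑[ i < order ] ∑[ j < order ] (β i j * w′ i + β i j * w′ j))
      ≡⟨ ∑∑-distrib-+ (λ i j → β i j * w′ i) (λ i j → β i j * w′ j) ⟩
    (∑[ i < order ] ∑[ j < order ] (β i j * w′ i)) + (∑[ i < order ] ∑[ j < order ] (β i j * w′ j))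
      ≡⟨ cong ((∑[ i < order ] ∑[ j < order ] (β i j * w′ i)) +_) (∑-comm (λ i j → β i j * w′ j)) ⟩
    (∑[ i < order ] ∑[ j < order ] (β i j * w′ i)) + (∑[ i < order ] ∑[ j < order ] (β j i * w′ i))
      ≡⟨ ∑∑-distrib-+ (λ i j → β i j * w′ i) (λ i j → β j i * w′ i) ⟨
    (∑[ i < order ] ∑[ j < order ] (β i j * w′ i + β j i * w′ i))
      ≡⟨ ∑∑-cong (λ i j → trans (sym (ℕₚ.*-distribʳ-+ (w′ i) (β i j) (β j i))) (cong (_* w′ i) (β-both i j))) ⟩
    (∑[ i < order ] ∑[ j < order ] (α i j * w′ i))
      ≡⟨ sum-cong-≗ (λ i → trans (sym (*-distribʳ-sum (w′ i) (α i))) (cong (_* w′ i) (sym (degree-sum (element i))))) ⟩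
    (∑[ i < order ] (degree (element i) * w′ i)) ∎
    where
    open ≡-Reasoning
    pairs : List (Fin order × Fin order)
    pairs = cartesianProduct (allFin order) (allFin order)

    w′ : Fin order → ℕ
    w′ = w ∘ element

    edge? : Decidable (λ (i , j) → toℕ i < toℕ j × Adjacent (element i) (element j))
    edge? (i , j) = (i Finₚ.<? j) ×-dec adjacent? (element i) (element j)

    α β : Fin order → Fin order → ℕ
    α i j = 𝟙 (adjacent? (element i) (element j))
    β i j = 𝟙 (edge? (i , j))

    β-both : ∀ i j → β i j + β j i ≡ α i j
    β-both i j with Finₚ.<-cmp i j
    ... | tri< i<j _ j≮i = trans
      (cong₂ _+_
        (𝟙-cong (edge? (i , j)) (adjacent? (element i) (element j)) proj₂ (i<j ,_))
        (𝟙-no (edge? (j , i)) (λ (j<i , _) → j≮i j<i)))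
      (ℕₚ.+-identityʳ (α i j))
    ... | tri> i≮j _ j<i = cong₂ _+_
      (𝟙-no (edge? (i , j)) (λ (i<j , _) → i≮j i<j))
      (𝟙-cong (edge? (j , i)) (adjacent? (element i) (element j))
        (adjacent-sym ∘ proj₂) (λ adj → j<i , adjacent-sym adj))
    ... | tri≈ _ refl _ = trans
      (cong₂ _+_ (𝟙-no (edge? (i , i)) (loopless ∘ proj₂)) (𝟙-no (edge? (i , i)) (loopless ∘ proj₂)))
      (sym (𝟙-no (adjacent? (element i) (element i)) loopless))
      where
      loopless : ¬ Adjacent (element i) (element i)
      loopless = adjacent-irrefl (Setoid.refl vertices)

    ∑∑-cong : {f g : Fin order → Fin order → ℕ} → (∀ i j → f i j ≡ g i j) →
      ∑[ i < order ] ∑[ j < order ] f i j ≡ ∑[ i < order ] ∑[ j < order ] g i j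
    ∑∑-cong f≡g = sum-cong-≗ (λ i → sum-cong-≗ (f≡g i))

    ∑∑-distrib-+ : (f g : Fin order → Fin order → ℕ) →
      ∑[ i < order ] ∑[ j < order ] (f i j + g i j) ≡
      (∑[ i < order ] ∑[ j < order ] f i j) + (∑[ i < order ] ∑[ j < order ] g i j)
    ∑∑-distrib-+ f g = trans (sum-cong-≗ (λ i → ∑-distrib-+ (f i) (g i)))
      (∑-distrib-+ (λ i → sum (f i)) (λ i → sum (g i)))

  -- The first endpoint stands for the common degree of an edge; doubling it gives the symmetric
  -- weight that the handshake argument requires.
  regular-edges-sum : (∀ {x y} → Adjacent x y → degree x ≡ degree y) →
    2 * sumOver (λ (x , y) → degree x) edges ≡ ∑[ i < order ] (degree (element i) * degree (element i))
  regular-edges-sum equal-degrees = trans (double edges edges-adjacent) (handshake degree)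
    where
    double : ∀ es → All (λ (x , y) → Adjacent x y) es →
      2 * sumOver (λ (x , y) → degree x) es ≡ sumOver (λ (x , y) → degree x + degree y) es
    double [] [] = refl
    double ((x , y) ∷ es) (adj ∷ adjs) = trans
      (ℕₚ.*-distribˡ-+ 2 (degree x) (sumOver (λ (x , y) → degree x) es))
      (cong₂ _+_ (cong (degree x +_) (trans (ℕₚ.+-identityʳ (degree x)) (equal-degrees adj)))
        (double es adjs))

-- Degrees in the total graph when Z(R) is a proper ideal

module _ {c ℓ} (R : CommutativeRing c ℓ) {n : ℕ} (enum : Enumeration (CommutativeRing.setoid R) n)
         (Z-proper : IsProperIdeal R (Z R)) where
  open import Data.Nat.Base using (_+_; _*_)
  open ≡ using (refl; sym; trans)

  private module R = CommutativeRing R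
  open IsProperIdeal Z-proper using () renaming (isIdeal to Z-isIdeal; proper to Z-isProper)
  open Ideal R Z-isIdeal
  open import Algebra.Properties.CommutativeSemigroup
    (CommutativeMonoid.commutativeSemigroup R.+-commutativeMonoid) using (interchange)
  open Finite enum using (element)
  open FiniteSimpleGraph (totalGraph R enum) using (degree; adjacent?; Adjacent)
  open Inverse enum using (to; to-cong; strictlyInverseʳ; strictlyInverseˡ)

  -- Adding x permutes the indices, with inverse adding - x. The permuted sum runs over
  -- representatives, so f has to respect `≈`.
  sum-translate : (f : R.Carrier → ℕ) → (∀ {x y} → x R.≈ y → f x ≡ f y) → ∀ x →
    ∑[ i < n ] f (x R.+ element i) ≡ ∑[ i < n ] f (element i)
  sum-translate f f-cong x = sym (trans
    (sum-permute (f ∘ element) (permutation (shift x) (shift (R.- x))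
      (shift-shift (R.-‿inverseʳ x)) (shift-shift (R.-‿inverseˡ x))))
    (sum-cong-≗ (λ i → f-cong (strictlyInverseʳ (x R.+ element i)))))
    where
    shift : R.Carrier → Fin n → Fin n
    shift y i = to (y R.+ element i)

    shift-shift : ∀ {y z} → y R.+ z R.≈ R.0# → ∀ i → shift y (shift z i) ≡ i
    shift-shift {y} {z} y+z≈0 i = trans
      (to-cong (R.trans (R.+-congˡ (strictlyInverseʳ (z R.+ element i)))
        (R.trans (R.sym (R.+-assoc y z (element i)))
        (R.trans (R.+-congʳ y+z≈0) (R.+-identityˡ (element i))))))
      (strictlyInverseˡ i)

  ζ : R.Carrier → ℕ
  ζ x = 𝟙 (Z? R enum x)

  υ : R.Carrier → ℕ
  υ x = 𝟙 (isUnit? R enum x)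

  ∣Z∣ : ℕ
  ∣Z∣ = ∑[ i < n ] ζ (element i)

  ζ-cong-⇔ : ∀ {x y} → (Z R x → Z R y) → (Z R y → Z R x) → ζ x ≡ ζ y
  ζ-cong-⇔ {x} {y} = 𝟙-cong (Z? R enum x) (Z? R enum y)

  ζ-cong : ∀ {x y} → x R.≈ y → ζ x ≡ ζ y
  ζ-cong x≈y = ζ-cong-⇔ (resp x≈y) (resp (R.sym x≈y))

  ∣U∣-sum : ∣U∣ R enum ≡ ∑[ i < n ] υ (element i)
  ∣U∣-sum = trans (length-filter (λ i → isUnit? R enum (element i)) (allFin n))
    (sumOver-tabulate (λ i → υ (element i)) id)

  ζ+υ≡1 : ∀ x → ζ x + υ x ≡ 1
  ζ+υ≡1 x = 𝟙-complement (Z? R enum x) (isUnit? R enum x)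
    (λ x∈Z unit → Z-isProper (unit∈⇒all unit x∈Z)) (nonunit⇒Z R enum)

  ∣Z∣+∣U∣≡n : ∣Z∣ + ∣U∣ R enum ≡ n
  ∣Z∣+∣U∣≡n = begin
    ∣Z∣ + ∣U∣ R enum                               ≡⟨ cong (∣Z∣ +_) ∣U∣-sum ⟩
    ∣Z∣ + (∑[ i < n ] υ (element i))               ≡⟨ ∑-distrib-+ (ζ ∘ element) (υ ∘ element) ⟨
    (∑[ i < n ] (ζ (element i) + υ (element i)))   ≡⟨ sum-cong-≗ (λ i → ζ+υ≡1 (element i)) ⟩
    (∑[ i < n ] 1)                                 ≡⟨ sum-const n 1 ⟩
    n * 1                                          ≡⟨ ℕₚ.*-identityʳ n ⟩
    n                                              ∎
    where open ≡-Reasoning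

  -- The translate x + R meets Z in ∣Z∣ elements; the summand y = x is no neighbour of x.
  degree+ζ : ∀ x → degree x + ζ (x R.+ x) ≡ ∣Z∣
  degree+ζ x = begin
    degree x + ζ (x R.+ x)
      ≡⟨ cong₂ _+_ (degree-sum (totalGraph R enum) x)
           (ζ-cong (R.+-congˡ (R.sym (strictlyInverseʳ x)))) ⟩
    (∑[ i < n ] 𝟙 (adjacent? x (element i))) + ζ (x R.+ element (to x))
      ≡⟨ sum-delete (λ i → 𝟙 (adjacent? x (element i))) (λ i → ζ (x R.+ element i)) (to x) self others ⟩
    (∑[ i < n ] ζ (x R.+ element i))
      ≡⟨ sum-translate ζ ζ-cong x ⟩
    ∣Z∣ ∎
    where
    open ≡-Reasoning
    self : 𝟙 (adjacent? x (element (to x))) ≡ 0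
    self = 𝟙-no (adjacent? x (element (to x))) (λ (x≉ , _) → x≉ (R.sym (strictlyInverseʳ x)))

    others : ∀ i → to x ≢ i → 𝟙 (adjacent? x (element i)) ≡ ζ (x R.+ element i)
    others i x≢i = 𝟙-cong (adjacent? x (element i)) (Z? R enum (x R.+ element i)) proj₂
      ((λ x≈i → x≢i (trans (to-cong x≈i) (strictlyInverseˡ i))) ,_)

  adjacent⇒degree≡ : ∀ {x y} → Adjacent x y → degree x ≡ degree y
  adjacent⇒degree≡ {x} {y} (_ , x+y∈Z) = ℕₚ.+-cancelʳ-≡ (ζ (x R.+ x)) (degree x) (degree y)
    (trans (degree+ζ x) (trans (sym (degree+ζ y))
      (cong (degree y +_) (ζ-cong-⇔ (double x+y∈Z) (double (resp (R.+-comm x y) x+y∈Z))))))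
    where
    -- 2y + 2x = 2(x + y)
    double : ∀ {x y} → Z R (y R.+ x) → Z R (x R.+ x) → Z R (y R.+ y)
    double {x} {y} x+y∈Z 2x∈Z = +-cancelˡ (resp (R.trans (interchange y x y x) (R.+-comm (y R.+ y) (x R.+ x)))
      (+-closed x+y∈Z x+y∈Z)) 2x∈Z

  -- The number |Z| - 1 without a subtraction: 0 + 0 lies in Z, so `degree+ζ` makes the degree of 0
  -- the predecessor of `∣Z∣`.
  0-neighbours : ℕ
  0-neighbours = degree R.0#

  ∣Z∣≡1+0-neighbours : ∣Z∣ ≡ ℕ.suc 0-neighbours
  ∣Z∣≡1+0-neighbours = trans (sym (degree+ζ R.0#))
    (trans (cong (0-neighbours +_) (𝟙-yes (Z? R enum (R.0# R.+ R.0#)) (+-closed 0∈ 0∈)))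
      (ℕₚ.+-comm 0-neighbours 1))

  x2≈x+x : ∀ x → x R.* 2# R R.≈ x R.+ x
  x2≈x+x x = R.trans (R.distribˡ x R.1# R.1#) (R.+-cong (R.*-identityʳ x) (R.*-identityʳ x))

  sum-degree²-nonunit : ¬ IsUnit R (2# R) →
    ∑[ i < n ] (degree (element i) * degree (element i)) ≡ n * (0-neighbours * 0-neighbours)
  sum-degree²-nonunit ¬unit = trans
    (sum-cong-≗ (λ i → cong₂ _*_ (regular (element i)) (regular (element i))))
    (sum-const n (0-neighbours * 0-neighbours))
    where
    -- The nonunit 2 lies in the ideal Z, hence so does every multiple x · 2. All vertices then have
    -- the same degree as 0.
    2x∈Z : ∀ x → Z R (x R.+ x)
    2x∈Z x = resp (x2≈x+x x) (*-absorb x (nonunit⇒Z R enum ¬unit))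

    regular : ∀ x → degree x ≡ 0-neighbours
    regular x = ℕₚ.+-cancelʳ-≡ (ζ (x R.+ x)) (degree x) 0-neighbours
      (trans (degree+ζ x) (trans (sym (degree+ζ R.0#))
        (cong (0-neighbours +_) (ζ-cong-⇔ (λ _ → 2x∈Z x) (λ _ → 2x∈Z R.0#)))))

  -- Now 2x ∈ Z exactly when x ∈ Z, so the correction in `degree+ζ` is `ζ x` itself.
  sum-degree²-unit : IsUnit R (2# R) →
    ∑[ i < n ] (degree (element i) * degree (element i)) ≡
    ∣Z∣ * (0-neighbours * 0-neighbours) + ∣U∣ R enum * (∣Z∣ * ∣Z∣)
  sum-degree²-unit (½ , ½2≈1 , _) = begin
    (∑[ i < n ] (degree (element i) * degree (element i)))
      ≡⟨ sum-cong-≗ (λ i → square (element i)) ⟩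
    (∑[ i < n ] (ζ (element i) * z² + υ (element i) * (∣Z∣ * ∣Z∣)))
      ≡⟨ ∑-distrib-+ (λ i → ζ (element i) * z²) (λ i → υ (element i) * (∣Z∣ * ∣Z∣)) ⟩
    (∑[ i < n ] (ζ (element i) * z²)) + (∑[ i < n ] (υ (element i) * (∣Z∣ * ∣Z∣)))
      ≡⟨ cong₂ _+_ (*-distribʳ-sum z² (ζ ∘ element)) (*-distribʳ-sum (∣Z∣ * ∣Z∣) (υ ∘ element)) ⟨
    ∣Z∣ * z² + (∑[ i < n ] υ (element i)) * (∣Z∣ * ∣Z∣)
      ≡⟨ cong (λ u → ∣Z∣ * z² + u * (∣Z∣ * ∣Z∣)) ∣U∣-sum ⟨
    ∣Z∣ * z² + ∣U∣ R enum * (∣Z∣ * ∣Z∣) ∎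
    where
    open ≡-Reasoning
    z² : ℕ
    z² = 0-neighbours * 0-neighbours

    2x∈Z⇒x∈Z : ∀ {x} → Z R (x R.+ x) → Z R x
    2x∈Z⇒x∈Z {x} 2x∈Z = resp ½2x≈x (*-absorb ½ 2x∈Z)
      where
      ½2x≈x : ½ R.* (x R.+ x) R.≈ x
      ½2x≈x = R.trans (R.*-congˡ (R.trans (R.sym (x2≈x+x x)) (R.*-comm x (2# R))))
        (R.trans (R.sym (R.*-assoc ½ (2# R) x)) (R.trans (R.*-congʳ ½2≈1) (R.*-identityˡ x)))

    -- Here b and u are the indicators of Z and U at one vertex. As b + u = 1, only two cases
    -- remain, and each selects one of the two squares.
    split : ∀ d b u z z′ → z ≡ ℕ.suc z′ → d + b ≡ z → b + u ≡ 1 → d * d ≡ b * (z′ * z′) + u * (z * z)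
    split d 0 1 z z′ z≡ d+0≡z refl =
      trans (cong (λ t → t * t) (trans (sym (ℕₚ.+-identityʳ d)) d+0≡z)) (sym (ℕₚ.+-identityʳ (z * z)))
    split d 1 0 z z′ z≡ d+1≡z refl = trans
      (cong (λ t → t * t) (ℕₚ.suc-injective (trans (ℕₚ.+-comm 1 d) (trans d+1≡z z≡))))
      (sym (trans (ℕₚ.+-identityʳ (1 * (z′ * z′))) (ℕₚ.+-identityʳ (z′ * z′))))

    square : ∀ x → degree x * degree x ≡ ζ x * z² + υ x * (∣Z∣ * ∣Z∣)
    square x = split (degree x) (ζ x) (υ x) ∣Z∣ 0-neighbours ∣Z∣≡1+0-neighbours
      (trans (cong (degree x +_) (ζ-cong-⇔ (λ x∈Z → +-closed x∈Z x∈Z) 2x∈Z⇒x∈Z)) (degree+ζ x))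
      (ζ+υ≡1 x)

-- Rational approximations of square roots

module _ where
  open import Data.Nat.Base using (_+_; _*_; _<_; _≤_)
  open ≡ using (refl; sym; trans)

  square-cancel-≤ : ∀ {m n} → m * m ≤ n * n → m ≤ n
  square-cancel-≤ {m} {n} m²≤n² with m ℕₚ.≤? n
  ... | yes m≤n = m≤n
  ... | no  m≰n = contradiction m²≤n² (ℕₚ.<⇒≱ (ℕₚ.*-mono-< (ℕₚ.≰⇒> m≰n) (ℕₚ.≰⇒> m≰n)))

  square-cancel-< : ∀ {m n} → m * m < n * n → m < n
  square-cancel-< {m} {n} m²<n² with m ℕₚ.<? n
  ... | yes m<n = m<n
  ... | no  m≮n = contradiction (ℕₚ.*-mono-≤ (ℕₚ.≮⇒≥ m≮n) (ℕₚ.≮⇒≥ m≮n)) (ℕₚ.<⇒≱ m²<n²)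

  square-* : ∀ x y → (x * y) * (x * y) ≡ (x * x) * (y * y)
  square-* = solve-∀

  -- Extracting d from under the floor is exact only up to d: multiplying s² ≤ k < (s + 1)² by d²
  -- places the root between ds and d(s + 1). After division by m + 1 this error tends to 0.
  isqrt-scale-lower : ∀ d k → d * isqrt k ≤ isqrt ((d * d) * k)
  isqrt-scale-lower d k = ℕₚ.≤-pred (square-cancel-< (begin-strict
    (d * s) * (d * s)       ≡⟨ square-* d s ⟩
    (d * d) * (s * s)       ≤⟨ ℕₚ.*-monoʳ-≤ (d * d) (isqrt-lower k) ⟩
    (d * d) * k             <⟨ isqrt-upper ((d * d) * k) ⟩
    suc r * suc r           ∎))
    where
    open ℕₚ.≤-Reasoning
    s = isqrt k
    r = isqrt ((d * d) * k)

  isqrt-scale-upper : ∀ d k → isqrt ((d * d) * k) ≤ d * suc (isqrt k)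
  isqrt-scale-upper d k = square-cancel-≤ (begin
    r * r                         ≤⟨ isqrt-lower ((d * d) * k) ⟩
    (d * d) * k                   ≤⟨ ℕₚ.*-monoʳ-≤ (d * d) (ℕₚ.<⇒≤ (isqrt-upper k)) ⟩
    (d * d) * (suc s * suc s)     ≡⟨ square-* d (suc s) ⟨
    (d * suc s) * (d * suc s)     ∎)
    where
    open ℕₚ.≤-Reasoning
    s = isqrt k
    r = isqrt ((d * d) * k)

  infix 8 _/1+_
  _/1+_ : ℕ → ℕ → ℚ
  a /1+ m = (ℤ.+ a) ℚ./ suc m

  /1+-≃ : ∀ a m → ℚ.toℚᵘ (a /1+ m) ℚᵘ.≃ mkℚᵘ (ℤ.+ a) m
  /1+-≃ a m = ℚₚ.toℚᵘ-fromℚᵘ (mkℚᵘ (ℤ.+ a) m)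

  /1+-mono-≤ : ∀ a m b n → a * suc n ≤ b * suc m → a /1+ m ℚ.≤ b /1+ n
  /1+-mono-≤ a m b n h = ℚₚ.toℚᵘ-cancel-≤
    (ℚᵘₚ.≤-respˡ-≃ (ℚᵘₚ.≃-sym (/1+-≃ a m)) (ℚᵘₚ.≤-respʳ-≃ (ℚᵘₚ.≃-sym (/1+-≃ b n))
      (ℚᵘ.*≤* (subst₂ ℤ._≤_ (ℤₚ.pos-* a (suc n)) (ℤₚ.pos-* b (suc m)) (ℤ.+≤+ h)))))

  /1+-mono-< : ∀ a m b n → a * suc n < b * suc m → a /1+ m ℚ.< b /1+ n
  /1+-mono-< a m b n h = ℚₚ.toℚᵘ-cancel-<
    (ℚᵘₚ.<-respˡ-≃ (ℚᵘₚ.≃-sym (/1+-≃ a m)) (ℚᵘₚ.<-respʳ-≃ (ℚᵘₚ.≃-sym (/1+-≃ b n))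
      (ℚᵘ.*<* (subst₂ ℤ._<_ (ℤₚ.pos-* a (suc n)) (ℤₚ.pos-* b (suc m)) (ℤ.+<+ h)))))

  /1+-cong : ∀ a m b n → a * suc n ≡ b * suc m → a /1+ m ≡ b /1+ n
  /1+-cong a m b n eq = ℚₚ.≤-antisym (/1+-mono-≤ a m b n (ℕₚ.≤-reflexive eq)) (/1+-mono-≤ b n a m (ℕₚ.≤-reflexive (sym eq)))

  /1+-+ : ∀ a b m → (a + b) /1+ m ≡ a /1+ m ℚ.+ b /1+ m
  /1+-+ a b m = ℚₚ.toℚᵘ-injective (begin
    ℚ.toℚᵘ ((a + b) /1+ m)                        ≈⟨ /1+-≃ (a + b) m ⟩
    mkℚᵘ (ℤ.+ (a + b)) m                            ≈⟨ ℚᵘ.*≡* cross ⟩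
    mkℚᵘ (ℤ.+ a) m ℚᵘ.+ mkℚᵘ (ℤ.+ b) m                ≈⟨ ℚᵘₚ.+-cong (/1+-≃ a m) (/1+-≃ b m) ⟨
    ℚ.toℚᵘ (a /1+ m) ℚᵘ.+ ℚ.toℚᵘ (b /1+ m)        ≈⟨ ℚₚ.toℚᵘ-homo-+ (a /1+ m) (b /1+ m) ⟨
    ℚ.toℚᵘ (a /1+ m ℚ.+ b /1+ m)                  ∎)
    where
    open import Relation.Binary.Reasoning.Setoid ℚᵘₚ.≃-setoid
    distrib : ∀ a b k → (a + b) * (k * k) ≡ (a * k + b * k) * k
    distrib = solve-∀
    cross : (ℤ.+ (a + b)) ℤ.* (ℤ.+ (suc m * suc m)) ≡ ((ℤ.+ a) ℤ.* (ℤ.+ suc m) ℤ.+ (ℤ.+ b) ℤ.* (ℤ.+ suc m)) ℤ.* (ℤ.+ suc m)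
    cross = trans (sym (ℤₚ.pos-* (a + b) (suc m * suc m)))
      (trans (cong ℤ.+_ (distrib a b (suc m)))
      (trans (ℤₚ.pos-* (a * suc m + b * suc m) (suc m))
        (cong (ℤ._* (ℤ.+ suc m)) (cong₂ ℤ._+_ (ℤₚ.pos-* a (suc m)) (ℤₚ.pos-* b (suc m))))))

  -- The successor of `n + m * suc n` is `suc m * suc n` by computation.
  /1+-* : ∀ a m b n → (a * b) /1+ (n + m * suc n) ≡ a /1+ m ℚ.* b /1+ n
  /1+-* a m b n = ℚₚ.toℚᵘ-injective (begin
    ℚ.toℚᵘ ((a * b) /1+ (n + m * suc n))          ≈⟨ /1+-≃ (a * b) (n + m * suc n) ⟩
    mkℚᵘ (ℤ.+ (a * b)) (n + m * suc n)              ≈⟨ ℚᵘ.*≡* (cong (ℤ._* (ℤ.+ (suc m * suc n))) (ℤₚ.pos-* a b)) ⟩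
    mkℚᵘ (ℤ.+ a) m ℚᵘ.* mkℚᵘ (ℤ.+ b) n                ≈⟨ ℚᵘₚ.*-cong (/1+-≃ a m) (/1+-≃ b n) ⟨
    ℚ.toℚᵘ (a /1+ m) ℚᵘ.* ℚ.toℚᵘ (b /1+ n)        ≈⟨ ℚₚ.toℚᵘ-homo-* (a /1+ m) (b /1+ n) ⟨
    ℚ.toℚᵘ (a /1+ m ℚ.* b /1+ n)                  ∎)
    where open import Relation.Binary.Reasoning.Setoid ℚᵘₚ.≃-setoid

  ι : ℕ → ℚ
  ι n = n /1+ 0

  ι-sub : ∀ a b {n} → a + b ≡ n → ι n ℚ.- ι b ≡ ι a
  ι-sub a b refl = begin
    ι (a + b) ℚ.- ι b           ≡⟨ cong (ℚ._- ι b) (/1+-+ a b 0) ⟩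
    (ι a ℚ.+ ι b) ℚ.- ι b       ≡⟨ ℚₚ.+-assoc (ι a) (ι b) (ℚ.- ι b) ⟩
    ι a ℚ.+ (ι b ℚ.- ι b)       ≡⟨ cong (ι a ℚ.+_) (ℚₚ.+-inverseʳ (ι b)) ⟩
    ι a ℚ.+ 0ℚ                  ≡⟨ ℚₚ.+-identityʳ (ι a) ⟩
    ι a                         ∎
    where open ≡-Reasoning

  recip-inverse : ∀ {q} → 0ℚ ℚ.< q → recip q ℚ.* q ≡ 1ℚ
  recip-inverse {q} q>0 with q ℚₚ.≟ 0ℚ
  ... | yes q≡0 = contradiction (sym q≡0) (ℚₚ.<⇒≢ q>0)
  ... | no  q≢0 = ℚₚ.*-inverseˡ q {{ℚ.≢-nonZero q≢0}}

  within-interval : ∀ {l w x y} → l ℚ.≤ x → x ℚ.≤ l ℚ.+ w → l ℚ.≤ y → y ℚ.≤ l ℚ.+ w → ∣ x ℚ.- y ∣ ℚ.≤ w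
  within-interval {l} {w} {x} {y} l≤x x≤l+w l≤y y≤l+w = case (ℚₚ.∣p∣≡p∨∣p∣≡-p (x ℚ.- y))
    where
    difference≤ : ∀ {x y} → x ℚ.≤ l ℚ.+ w → l ℚ.≤ y → x ℚ.- y ℚ.≤ w
    difference≤ x≤l+w l≤y = subst (_ ℚ.≤_) (xyx⁻¹≈y l w) (ℚₚ.+-mono-≤ x≤l+w (ℚₚ.neg-antimono-≤ l≤y))

    case : ∣ x ℚ.- y ∣ ≡ x ℚ.- y ⊎ ∣ x ℚ.- y ∣ ≡ ℚ.- (x ℚ.- y) → ∣ x ℚ.- y ∣ ℚ.≤ w
    case (inj₁ eq) = subst (ℚ._≤ w) (sym eq) (difference≤ x≤l+w l≤y)
    case (inj₂ eq) = subst (ℚ._≤ w) (sym (trans eq (⁻¹-anti-homo-// x y))) (difference≤ y≤l+w l≤x)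

  ≃-from-rate : ∀ {x y} C → (∀ m → ∣ seq x m ℚ.- seq y m ∣ ℚ.≤ C /1+ m) → x ≃ y
  -- For ε = (p + 1)/(q + 1), C/(m + 1) < ε as soon as m + 1 > C(q + 1), since p + 1 ≥ 1.
  ≃-from-rate C close (mkℚ (ℤ.+ suc p) q cp) _ = C * suc q , λ m m≥ → ℚₚ.≤-<-trans (close m)
    (subst (C /1+ m ℚ.<_) (ℚₚ.↥p/↧p≡p (mkℚ (ℤ.+ suc p) q cp))
      (/1+-mono-< C m (suc p) q (ℕₚ.<-≤-trans (s≤s m≥) (ℕₚ.m≤n*m (suc m) (suc p)))))
  ≃-from-rate C close (mkℚ (ℤ.+ 0) q cp) ε>0 with () ← ℚ.positive ε>0
  ≃-from-rate C close (mkℚ -[1+ p ] q cp) ε>0 with () ← ℚ.positive ε>0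

  -- Allows the exact algebra on the right-hand side to be done term by term in ℚ, with no further
  -- limit argument.
  ≃-respʳ : ∀ {x y z} → x ≃ y → (∀ m → seq y m ≡ seq z m) → x ≃ z
  ≃-respʳ {x} x≃y y≡z ε ε>0 with x≃y ε ε>0
  ... | N , close = N , λ m m≥ → subst (λ t → ∣ seq x m ℚ.- t ∣ ℚ.< ε) (y≡z m) (close m m≥)

  module _ (m : ℕ) where
    private
      M = suc m
      s = isqrt (2 * (M * M))
      b = s /1+ m
      b⁻¹ = recip b

    1≤isqrt : 1 ≤ s
    1≤isqrt = ℕₚ.≤-pred (square-cancel-< {1} {suc s}
      (ℕₚ.<-≤-trans (s≤s (s≤s z≤n)) (ℕₚ.<⇒≤ (ℕₚ.≤-<-trans (ℕₚ.*-monoʳ-≤ 2 (s≤s (z≤n {m + m * suc m})))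
        (isqrt-upper (2 * (M * M)))))))

    -- Ensures that `recip b` is a true inverse and not the default value at 0.
    b>0 : 0ℚ ℚ.< b
    b>0 = /1+-mono-< 0 0 s m (ℕₚ.<-≤-trans 1≤isqrt (ℕₚ.≤-reflexive (sym (ℕₚ.*-identityʳ s))))

    private
      cancel-b : ∀ {x y} → x ℚ.* b ℚ.≤ y ℚ.* b → x ℚ.≤ y
      cancel-b = ℚₚ.*-cancelʳ-≤-pos b {{ℚ.positive b>0}}

      2b⁻¹b≡2 : (ι 2 ℚ.* b⁻¹) ℚ.* b ≡ ι 2
      2b⁻¹b≡2 = trans (ℚₚ.*-assoc (ι 2) b⁻¹ b)
        (trans (cong (ι 2 ℚ.*_) (recip-inverse b>0)) (ℚₚ.*-identityʳ (ι 2)))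

    -- After multiplication by b this is b² ≤ 2, the lower bound defining the integer square root.
    √2≤2/√2 : b ℚ.≤ ι 2 ℚ.* b⁻¹
    √2≤2/√2 = cancel-b (subst₂ ℚ._≤_ (/1+-* s m s m) (sym 2b⁻¹b≡2)
      (/1+-mono-≤ (s * s) (m + m * suc m) 2 0
        (ℕₚ.≤-trans (ℕₚ.≤-reflexive (ℕₚ.*-identityʳ (s * s))) (isqrt-lower (2 * (M * M))))))

    -- After multiplication by b the claim is 2M² ≤ (s + 3)s. From 2M² < (s + 1)² one gets 2M² ≤ (s
    -- + 2)s, and the constant 3 leaves a margin.
    2/√2≤√2 : ι 2 ℚ.* b⁻¹ ℚ.≤ b ℚ.+ 3 /1+ m
    2/√2≤√2 = cancel-b (subst₂ ℚ._≤_ (sym 2b⁻¹b≡2)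
      (trans (/1+-* (s + 3) m s m) (cong (ℚ._* b) (/1+-+ s 3 m)))
      (/1+-mono-≤ 2 0 ((s + 3) * s) (m + m * suc m) (begin
        2 * (M * M)            ≤⟨ ℕₚ.≤-pred (isqrt-upper (2 * (M * M))) ⟩
        s + s * suc s          ≡⟨ rearrange s ⟩
        (s + 2) * s            ≤⟨ ℕₚ.*-monoˡ-≤ s (ℕₚ.+-monoʳ-≤ s (ℕₚ.n≤1+n 2)) ⟩
        (s + 3) * s            ≡⟨ ℕₚ.*-identityʳ ((s + 3) * s) ⟨
        (s + 3) * s * 1        ∎)))
      where
      open ℕₚ.≤-Reasoning
      rearrange : ∀ s → s + s * suc s ≡ (s + 2) * s
      rearrange = solve-∀

    module _ (D : ℕ) where
      ι-D* : ∀ k → ι D ℚ.* k /1+ m ≡ (D * k) /1+ m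
      ι-D* k = trans (sym (/1+-* D 0 k m))
        (/1+-cong (D * k) (m + 0) (D * k) m (cong (λ t → D * k * suc t) (sym (ℕₚ.+-identityʳ m))))

      ι-2D : ι (2 * D) ℚ.* b⁻¹ ≡ ι D ℚ.* (ι 2 ℚ.* b⁻¹)
      ι-2D = trans (cong (λ t → ι t ℚ.* b⁻¹) (ℕₚ.*-comm 2 D))
        (trans (cong (ℚ._* b⁻¹) (/1+-* D 0 2 0)) (ℚₚ.*-assoc (ι D) (ι 2) b⁻¹))

      ι-D-mono : ∀ {x y} → x ℚ.≤ y → ι D ℚ.* x ℚ.≤ ι D ℚ.* y
      ι-D-mono = ℚₚ.*-monoˡ-≤-nonNeg (ι D) {{ℚ.nonNegative (/1+-mono-≤ 0 0 D 0 z≤n)}}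

      2D/√2-lower : (D * s) /1+ m ℚ.≤ ι (2 * D) ℚ.* b⁻¹
      2D/√2-lower = subst₂ ℚ._≤_ (ι-D* s) (sym ι-2D) (ι-D-mono √2≤2/√2)

      2D/√2-upper : ι (2 * D) ℚ.* b⁻¹ ℚ.≤ (D * s) /1+ m ℚ.+ (D * 3) /1+ m
      2D/√2-upper = subst₂ ℚ._≤_ (sym ι-2D)
        (trans (ℚₚ.*-distribˡ-+ (ι D) b (3 /1+ m)) (cong₂ ℚ._+_ (ι-D* s) (ι-D* 3)))
        (ι-D-mono 2/√2≤√2)

  module _ (f d : A → ℕ) where
    -- The m-th approximations of all the roots share the denominator m + 1, so estimating their sum
    -- is a matter of natural numbers.
    √-sum-numerator : ℕ → List A → ℕ
    √-sum-numerator m = sumOver (λ x → isqrt (f x * (suc m * suc m)))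

    seq-√-sum : ∀ m xs → seq (sumℝ (λ x → √ f x) xs) m ≡ √-sum-numerator m xs /1+ m
    seq-√-sum m [] = /1+-cong 0 0 0 m refl
    seq-√-sum m (x ∷ xs) = trans
      (cong (√-seq (f x) m ℚ.+_) (seq-√-sum m xs))
      (sym (/1+-+ (isqrt (f x * (suc m * suc m))) (√-sum-numerator m xs) m))

    -- Each radicand, scaled by (m + 1)², is (d x)² times the same K, so the scaling bounds apply
    -- with one common s and add up along the list.
    numerator-bounds : ∀ m xs → All (λ x → f x ≡ 2 * (d x * d x)) xs →
      let s = isqrt (2 * (suc m * suc m)) in
      sumOver d xs * s ≤ √-sum-numerator m xs × √-sum-numerator m xs ≤ sumOver d xs * suc s
    numerator-bounds m [] [] = z≤n , z≤n
    numerator-bounds m (x ∷ xs) (eq ∷ eqs) with numerator-bounds m xs eqs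
    ... | lower , upper =
      ≤-trans (≤-reflexive (ℕₚ.*-distribʳ-+ s (d x) (sumOver d xs)))
        (ℕₚ.+-mono-≤ (≤-trans (isqrt-scale-lower (d x) K) (≤-reflexive (cong isqrt (sym scaled)))) lower) ,
      ≤-trans
        (ℕₚ.+-mono-≤ (≤-trans (≤-reflexive (cong isqrt scaled)) (isqrt-scale-upper (d x) K)) upper)
        (≤-reflexive (sym (ℕₚ.*-distribʳ-+ (suc s) (d x) (sumOver d xs))))
      where
      open ℕₚ using (≤-trans; ≤-reflexive)
      K = 2 * (suc m * suc m)
      s = isqrt K
      regroup : ∀ d k → 2 * (d * d) * k ≡ (d * d) * (2 * k)
      regroup = solve-∀
      scaled : f x * (suc m * suc m) ≡ (d x * d x) * K
      scaled = trans (cong (_* (suc m * suc m)) eq) (regroup (d x) (suc m * suc m))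

    -- Both sequences lie in the interval [ D b , D b + 3 D / (m + 1) ], where b
    -- is the m-th approximation of √2 and D = Σ d x.
    √-sum-≃ : ∀ xs → All (λ x → f x ≡ 2 * (d x * d x)) xs →
      sumℝ (λ x → √ f x) xs ≃ fromℕ (2 * sumOver d xs) / √ 2
    √-sum-≃ xs eqs = ≃-from-rate {sumℝ (λ x → √ f x) xs} {fromℕ (2 * D) / √ 2} (D * 3) (λ m →
      let s = isqrt (2 * (suc m * suc m))
          (lower , upper) = numerator-bounds m xs eqs
          eq = seq-√-sum m xs
          N = √-sum-numerator m xs
      in within-interval {(D * s) /1+ m}
           (subst ((D * s) /1+ m ℚ.≤_) (sym eq) (/1+-mono-≤ (D * s) m N m (ℕₚ.*-monoˡ-≤ (suc m) lower)))
           (subst₂ ℚ._≤_ (sym eq) (/1+-+ (D * s) (D * 3) m)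
             (/1+-mono-≤ N m (D * s + D * 3) m (ℕₚ.*-monoˡ-≤ (suc m) (ℕₚ.≤-trans upper (weaken s)))))
           (2D/√2-lower m D)
           (2D/√2-upper m D))
      where
      D = sumOver d xs
      weaken : ∀ s → D * suc s ≤ D * s + D * 3
      weaken s = ℕₚ.≤-trans (ℕₚ.≤-reflexive (trans (ℕₚ.*-suc D s) (ℕₚ.+-comm D (D * s))))
        (ℕₚ.+-monoʳ-≤ (D * s) (ℕₚ.m≤m*n D 3))

-- The Sombor index when adjacent vertices have equal degrees

module _ {v e a} (G : FiniteSimpleGraph v e a) where
  open import Data.Nat.Base using (_+_; _*_)
  open ≡ using (refl)

  open FiniteSimpleGraph G hiding (SO)
  open Finite enumeration using (element)

  SO-equal-degrees : (∀ {x y} → Adjacent x y → degree x ≡ degree y) →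
    SO G ≃ fromℕ (∑[ i < order ] (degree (element i) * degree (element i))) / √ 2
  SO-equal-degrees equal-degrees = subst (λ S → SO G ≃ fromℕ S / √ 2)
    (regular-edges-sum G equal-degrees)
    (√-sum-≃ (λ (x , y) → degree x ℕ.^ 2 + degree y ℕ.^ 2) (λ (x , y) → degree x) edges
      (All.map (λ { {x , y} adj → double (equal-degrees adj) }) (edges-adjacent G)))
    where
    double : ∀ {m n} → m ≡ n → m ℕ.^ 2 + n ℕ.^ 2 ≡ 2 * (m * m)
    double {m} refl = square m
      where
      square : ∀ m → m * (m * 1) + m * (m * 1) ≡ 2 * (m * m)
      square = solve-∀

-- The closed formulas over the rationals

module _ where
  open import Data.Nat.Base using (_+_; _*_)
  open ≡ using (sym; trans)

  ι-*-square : ∀ a b → ι (a * (b * b)) ≡ ι a ℚ.* (ι b ℚ.* ι b)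
  ι-*-square a b = trans (/1+-* a 0 (b * b) 0) (cong (ι a ℚ.*_) (/1+-* b 0 b 0))

  module _ {n u z k : ℕ} (z+u≡n : z + u ≡ n) (z≡1+k : z ≡ suc k) where
    -- The formulas subtract real numbers, whereas the counts are related only by sums of naturals;
    -- this is where the two meet.
    ι-z : ι z ≡ ι n ℚ.- ι u
    ι-z = sym (ι-sub z u z+u≡n)

    ι-k : ι k ≡ ι n ℚ.- ι u ℚ.- ι 1
    ι-k = trans (sym (ι-sub k 1 (trans (ℕₚ.+-comm k 1) (sym z≡1+k)))) (cong (ℚ._- ι 1) ι-z)

    ι-nonunit-formula : let x = ι n ℚ.- ι u ℚ.- ι 1 in
      ι (n * (k * k)) ≡ ι n ℚ.* (x ℚ.* x)
    ι-nonunit-formula = trans (ι-*-square n k) (cong (λ t → ι n ℚ.* (t ℚ.* t)) ι-k)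

    ι-unit-formula : let y = ι n ℚ.- ι u; x = y ℚ.- ι 1 in
      ι (z * (k * k) + u * (z * z)) ≡ y ℚ.* (x ℚ.* x) ℚ.+ ι u ℚ.* (y ℚ.* y)
    ι-unit-formula = trans (/1+-+ (z * (k * k)) (u * (z * z)) 0) (cong₂ ℚ._+_
      (trans (ι-*-square z k) (cong₂ (λ s t → s ℚ.* (t ℚ.* t)) ι-z ι-k))
      (trans (ι-*-square u z) (cong (λ t → ι u ℚ.* (t ℚ.* t)) ι-z)))

open import Defs

theorem5p1 : ∀ {c ℓ} (R : CommutativeRing c ℓ) (n : ℕ)
    (enum : Enumeration (CommutativeRing.setoid R) n) →
    IsLocal R →
    let N = fromℕ n
        U = fromℕ (∣U∣ R enum)
    in
    (¬ IsUnit R (2# R) →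
      SO (totalGraph R enum) ≃ (N * (N - U - 1ℝ) ²) / (√ 2)) ×
    (IsUnit R (2# R) →
      SO (totalGraph R enum) ≃ ((N - U) * (N - U - 1ℝ) ²) / (√ 2) + (U * (N - U) ²) / (√ 2))
theorem5p1 R n enum local =
  (λ ¬unit → ≃-respʳ {SO G} {SO-value} {(N * (N - U - 1ℝ) ²) / (√ 2)} SO≃
    -- Real operations act termwise, so at index m both sides are a constant rational times the same
    -- approximation of 1/√2.
    (λ m → cong (ℚ._* recip (√-seq 2 m))
      (≡.trans (cong ι (sum-degree²-nonunit R enum Z-proper ¬unit))
        (ι-nonunit-formula z+u≡n z≡1+k)))) ,
  (λ unit → ≃-respʳ {SO G} {SO-value} {((N - U) * (N - U - 1ℝ) ²) / (√ 2) + (U * (N - U) ²) / (√ 2)} SO≃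
    (λ m → ≡.trans
      (cong (ℚ._* recip (√-seq 2 m))
        (≡.trans (cong ι (sum-degree²-unit R enum Z-proper unit))
          (ι-unit-formula z+u≡n z≡1+k)))
      -- The single fraction is broken into the two fractions of the stated formula.
      (ℚₚ.*-distribʳ-+ (recip (√-seq 2 m)) (seq ((N - U) * (N - U - 1ℝ) ²) m) (seq (U * (N - U) ²) m))))
  where
  G = totalGraph R enum
  N = fromℕ n
  U = fromℕ (∣U∣ R enum)
  Z-proper = local⇒Z-proper R enum local
  z+u≡n = ∣Z∣+∣U∣≡n R enum Z-proper
  z≡1+k = ∣Z∣≡1+0-neighbours R enum Z-proper
  open FiniteSimpleGraph G using (degree)
  open Finite enum using (element)

  SO-value : ℝ
  SO-value = fromℕ (∑[ i < n ] (degree (element i) ℕ.* degree (element i))) / √ 2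

  SO≃ : SO G ≃ SO-value
  SO≃ = SO-equal-degrees G (adjacent⇒degree≡ R enum Z-proper)
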